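{- The Greedy heuristic for the Euclidean TSP is scalefree (in the simple sense defined in the context).
   Context: **Greedy.** Given a finite point set $X\subset\mathbb R^d$, $\textsc{Greedy}(X)$ produces a tour (Hamilton cycle) by adding, at each step, the shortest edge which would not create a non-Hamilton cycle or a vertex of degree $3$. If there are ties its behavior is unspecified. **General position.** A set of $m$ points with pairwise Euclidean distances $d_1,\dots,d_{\binom m2}$ is in general position if $\sum_i\xi_id_i\ne0$ for every choice of $\xi_i\in\{0,1,-1\}$ not all zero. **Path-finding heuristic.** A polynomial-time path-finding heuristic is an algorithm which has access to a blackbox for comparing sums of distances among the input points and which, given the distance matrix of a point set in general position, outputs a list of Hamilton paths through the point set in time polynomial in the number of points. **Scalefree (simple sense).** $B(p,r)$ denotes the Euclidean ball of radius $r$ centered at $p$. A TSP heuristic $H$ is scalefree if there exist a constant $R$ and a polynomial-time path-finding heuristic $A_H$ such that, given any input set $X$ for $H$, the following implication holds for all sets $S_p=B(p,1)\cap X$: if (a) the annulus $B(p,R)\setminus B(p,1)$ contains no points of $X$, and (b) the points of $S_p$ are in general position, then $H$ traverses $S_p$ in a path, which belongs to the list produced by $A_H$ when a congruent copy of $S_p$ is used as the input to $A_H$. -}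

module Defs where

open import Algebra.Bundles using (CommutativeRing)
open import Algebra.Structures using (IsCommutativeRing)
import Algebra.Properties.Ring as RingProperties
import Algebra.Solver.Ring.NaturalCoefficients.Default as SemiringSolver
open import Data.Fin using (Fin; toℕ)
import Data.Fin.Properties as Fin
open import Data.List using (List; []; _∷_; [_]; _++_; length; map; foldr; filter; allFin; cartesianProduct)
import Data.List as List
open import Data.List.Membership.Propositional using (_∈_)
open import Data.List.Relation.Binary.Permutation.Propositional using (_↭_)
open import Data.List.Relation.Unary.All using (All)
open import Data.List.Relation.Unary.Unique.Propositional using (Unique)
open import Data.Nat as ℕ using (ℕ; zero; suc)
open import Data.Product using (Σ; ∃; ∃-syntax; _×_; _,_; proj₁; proj₂)
open import Data.Sum using (_⊎_; inj₁; inj₂)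
open import Data.Vec using (Vec; []; _∷_)
import Data.Vec as Vec
open import Function.Definitions using (Injective)
open import Function.Bundles using (_⤖_; _⇔_; module Bijection)
open import Level using (0ℓ)
open import Relation.Binary.Definitions using (tri<; tri≈; tri>)
open import Relation.Binary.PropositionalEquality using (_≡_; _≢_; refl; sym; trans; cong; cong₂; subst; subst₂)
open import Relation.Binary.Structures using (IsStrictTotalOrder; IsDecTotalOrder)
import Relation.Binary.Construct.StrictToNonStrict as StrictToNonStrict
open import Relation.Nullary using (¬_; contradiction)
open import Relation.Nullary.Decidable using (_⊎-dec_)

------------------------------------------------------------------------
-- The real numbers, axiomatised as a Dedekind-complete ordered field.
-- Classically these axioms determine ℝ up to unique isomorphism; the
-- order is decidable and suprema of arbitrary subsets exist, so this is
-- the classical real line and not a constructive surrogate.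

record Reals : Set₁ where
  infix  8 -_
  infixl 7 _*_
  infixl 6 _+_
  infix  4 _<_ _≤_
  field
    ℝ       : Set
    _+_ _*_ : ℝ → ℝ → ℝ
    -_      : ℝ → ℝ
    0# 1#   : ℝ
    _<_     : ℝ → ℝ → Set
    isCommutativeRing  : IsCommutativeRing _≡_ _+_ _*_ -_ 0# 1#
    isStrictTotalOrder : IsStrictTotalOrder _≡_ _<_
    0<1     : 0# < 1#
    inverse : ∀ x → x ≢ 0# → ∃[ y ] x * y ≡ 1#
    +-monoˡ-< : ∀ z {x y} → x < y → x + z < y + z
    *-pos     : ∀ {x y} → 0# < x → 0# < y → 0# < x * y

  _≤_ : ℝ → ℝ → Set
  _≤_ = StrictToNonStrict._≤_ _≡_ _<_

  UpperBound : (ℝ → Set) → ℝ → Set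
  UpperBound P b = ∀ x → P x → x ≤ b

  field
    supremum : (P : ℝ → Set) → ∃ P → ∃ (UpperBound P) →
               ∃[ s ] UpperBound P s × (∀ b → UpperBound P b → s ≤ b)

  commutativeRing : CommutativeRing 0ℓ 0ℓ
  commutativeRing = record { isCommutativeRing = isCommutativeRing }

  open CommutativeRing commutativeRing public using (_-_)

  isDecTotalOrder : IsDecTotalOrder _≡_ _≤_
  isDecTotalOrder = StrictToNonStrict.isDecTotalOrder _≡_ _<_ isStrictTotalOrder

  open IsStrictTotalOrder isStrictTotalOrder public
    using (compare; _<?_) renaming (trans to <-trans; irrefl to <-irrefl)
  open IsDecTotalOrder isDecTotalOrder public
    using (_≤?_) renaming (refl to ≤-refl; trans to ≤-trans; antisym to ≤-antisym; total to ≤-total)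

------------------------------------------------------------------------
-- Square roots of nonnegative reals, obtained from completeness

module SquareRoot (𝕣 : Reals) where
  open Reals 𝕣
  open CommutativeRing commutativeRing
    using (+-comm; +-assoc; +-identityˡ; +-identityʳ; -‿inverseˡ; -‿inverseʳ; *-comm; *-assoc
          ; *-identityˡ; *-identityʳ; zeroˡ; zeroʳ; distribʳ; ring; commutativeSemiring)
  open RingProperties ring using (+-cancelʳ; -‿distribˡ-*; -‿distribʳ-*; -‿involutive)
  open SemiringSolver commutativeSemiring using (solve; _:=_; _:+_; _:*_)

  ≮⇒≥ : ∀ {x y} → ¬ x < y → y ≤ x
  ≮⇒≥ {x} {y} x≮y with compare x y
  ... | tri< x<y _ _ = contradiction x<y x≮y
  ... | tri≈ _ x≡y _ = inj₂ (sym x≡y)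
  ... | tri> _ _ y<x = inj₁ y<x

  <-≤-trans : ∀ {x y z} → x < y → y ≤ z → x < z
  <-≤-trans x<y (inj₁ y<z)  = <-trans x<y y<z
  <-≤-trans x<y (inj₂ refl) = x<y

  ≤-<-trans : ∀ {x y z} → x ≤ y → y < z → x < z
  ≤-<-trans (inj₁ x<y)  y<z = <-trans x<y y<z
  ≤-<-trans (inj₂ refl) y<z = y<z

  <⇒≱ : ∀ {x y} → x < y → ¬ y ≤ x
  <⇒≱ x<y y≤x = <-irrefl refl (<-≤-trans x<y y≤x)

  +-monoʳ-< : ∀ z {x y} → x < y → z + x < z + y
  +-monoʳ-< z {x} {y} x<y = subst₂ _<_ (+-comm x z) (+-comm y z) (+-monoˡ-< z x<y)

  +-monoʳ-≤ : ∀ z {x y} → x ≤ y → z + x ≤ z + y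
  +-monoʳ-≤ z (inj₁ x<y)  = inj₁ (+-monoʳ-< z x<y)
  +-monoʳ-≤ z (inj₂ refl) = inj₂ refl

  x<x+y : ∀ x {y} → 0# < y → x < x + y
  x<x+y x {y} 0<y = subst (_< x + y) (+-identityʳ x) (+-monoʳ-< x 0<y)

  x≤x+y : ∀ x {y} → 0# ≤ y → x ≤ x + y
  x≤x+y x {y} 0≤y = subst (_≤ x + y) (+-identityʳ x) (+-monoʳ-≤ x 0≤y)

  +-nonNeg : ∀ {x y} → 0# ≤ x → 0# ≤ y → 0# ≤ x + y
  +-nonNeg 0≤x 0≤y = ≤-trans 0≤x (x≤x+y _ 0≤y)

  *-nonNeg : ∀ {x y} → 0# ≤ x → 0# ≤ y → 0# ≤ x * y
  *-nonNeg (inj₁ 0<x)  (inj₁ 0<y)      = inj₁ (*-pos 0<x 0<y)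
  *-nonNeg {x} _       (inj₂ refl)     = inj₂ (sym (zeroʳ x))
  *-nonNeg {_} {y} (inj₂ refl) (inj₁ _) = inj₂ (sym (zeroˡ y))

  <⇒gap : ∀ {x y} → x < y → ∃[ g ] (0# < g × x + g ≡ y)
  <⇒gap {x} {y} x<y = y - x
    , subst (_< y - x) (-‿inverseʳ x) (+-monoˡ-< (- x) x<y)
    , trans (+-comm x (y - x)) (trans (+-assoc y (- x) x) (trans (cong (y +_) (-‿inverseˡ x)) (+-identityʳ y)))

  *-monoˡ-< : ∀ {z} → 0# < z → ∀ {x y} → x < y → x * z < y * z
  *-monoˡ-< {z} 0<z {x} x<y with g , 0<g , refl ← <⇒gap x<y =
    subst (x * z <_) (sym (distribʳ z x g)) (x<x+y (x * z) (*-pos 0<g 0<z))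

  *-monoˡ-≤ : ∀ {z} → 0# ≤ z → ∀ {x y} → x ≤ y → x * z ≤ y * z
  *-monoˡ-≤ _          (inj₂ refl) = inj₂ refl
  *-monoˡ-≤ (inj₁ 0<z) (inj₁ x<y)  = inj₁ (*-monoˡ-< 0<z x<y)
  *-monoˡ-≤ (inj₂ refl) {x} {y} _  = inj₂ (trans (zeroʳ x) (sym (zeroʳ y)))

  square-mono-< : ∀ {x y} → 0# ≤ x → x < y → x * x < y * y
  square-mono-< {x} {y} 0≤x x<y =
    ≤-<-trans (*-monoˡ-≤ 0≤x (inj₁ x<y))
              (subst (_< y * y) (*-comm x y) (*-monoˡ-< (≤-<-trans 0≤x x<y) x<y))

  square-nonNeg : ∀ x → 0# ≤ x * x
  square-nonNeg x with compare 0# x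
  ... | tri< 0<x _ _  = inj₁ (*-pos 0<x 0<x)
  ... | tri≈ _ refl _ = inj₂ (sym (zeroˡ 0#))
  ... | tri> _ _ x<0  = subst (0# ≤_) ([-x]²≡x²) (inj₁ (*-pos 0<-x 0<-x))
    where
    [-x]²≡x² : - x * - x ≡ x * x
    [-x]²≡x² = trans (sym (-‿distribˡ-* x (- x))) (trans (cong -_ (sym (-‿distribʳ-* x x))) (-‿involutive (x * x)))
    0<-x : 0# < - x
    0<-x = subst₂ _<_ (-‿inverseʳ x) (+-identityˡ (- x)) (+-monoˡ-< (- x) x<0)

  -- Division of a positive real by a positive real.
  divide : ∀ {a b} → 0# < a → 0# < b → ∃[ q ] (0# < q × q * b ≡ a)
  divide {a} {b} 0<a 0<b with inverse b (λ b≡0 → <-irrefl (sym b≡0) 0<b)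
  ... | b⁻¹ , bb⁻¹≡1 = q , 0<q , qb≡a
    where
    q = a * b⁻¹
    qb≡a : q * b ≡ a
    qb≡a = trans (*-assoc a b⁻¹ b) (trans (cong (a *_) (trans (*-comm b⁻¹ b) bb⁻¹≡1)) (*-identityʳ a))
    0<q : 0# < q
    0<q with compare 0# q
    ... | tri< 0<q _ _ = 0<q
    ... | tri≈ _ 0≡q _ = contradiction (trans (sym (zeroˡ b)) (trans (cong (_* b) 0≡q) qb≡a)) (λ 0≡a → <-irrefl 0≡a 0<a)
    ... | tri> _ _ q<0 = contradiction (subst₂ _<_ qb≡a (zeroˡ b) (*-monoˡ-< 0<b q<0)) (λ a<0 → <⇒≱ 0<a (inj₁ a<0))

  sqrt : ∀ x → 0# ≤ x → ∃[ s ] (0# ≤ s × s * s ≡ x)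
  sqrt x 0≤x with supremum Below (0# , inj₂ refl , subst (_≤ x) (sym (zeroˡ 0#)) 0≤x) (x + 1# , bounded)
    where
    Below : ℝ → Set
    Below y = 0# ≤ y × y * y ≤ x
    bounded : UpperBound Below (x + 1#)
    bounded y (_ , y²≤x) = ≮⇒≥ λ x+1<y →
      let 1≤x+1 = subst (1# ≤_) (+-comm 1# x) (x≤x+y 1# 0≤x)
          0≤x+1 = ≤-trans (inj₁ 0<1) 1≤x+1
          x≤x+1 = x≤x+y x (inj₁ 0<1)
          x+1≤[x+1]² = subst (_≤ (x + 1#) * (x + 1#)) (*-identityˡ (x + 1#)) (*-monoˡ-≤ 0≤x+1 1≤x+1)
      in <⇒≱ (≤-<-trans (≤-trans x≤x+1 x+1≤[x+1]²) (square-mono-< 0≤x+1 x+1<y)) y²≤x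
  ... | s , upper , least = s , 0≤s , s²≡x
    where
    0≤s : 0# ≤ s
    0≤s = upper 0# (inj₂ refl , subst (_≤ x) (sym (zeroˡ 0#)) 0≤x)

    s²≮x : ¬ s * s < x
    s²≮x s²<x with δ , 0<δ , s²+δ≡x ← <⇒gap s²<x = <⇒≱ (x<x+y s 0<ε) (upper (s + ε) (0≤s+ε , [s+ε]²≤x))
      where
      a = (s + s + 1#) + δ
      0<2s+1 : 0# < s + s + 1#
      0<2s+1 = ≤-<-trans (+-nonNeg 0≤s 0≤s) (x<x+y (s + s) 0<1)
      0<a : 0# < a
      0<a = <-trans 0<2s+1 (x<x+y _ 0<δ)
      quotient = divide 0<δ 0<a
      ε = proj₁ quotient
      0<ε = proj₁ (proj₂ quotient)
      εa≡δ : ε * a ≡ δ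
      εa≡δ = proj₂ (proj₂ quotient)
      0≤s+ε = +-nonNeg 0≤s (inj₁ 0<ε)
      δ<a : δ < a
      δ<a = subst (δ <_) (+-comm δ _) (x<x+y δ 0<2s+1)
      ε≤1 : ε ≤ 1#
      ε≤1 = ≮⇒≥ λ 1<ε → <⇒≱ (<-trans (subst (_< ε * a) (*-identityˡ a) (*-monoˡ-< 0<a 1<ε)) (subst (_< a) (sym εa≡δ) δ<a)) (inj₂ refl)
      2s+ε≤a : s + s + ε ≤ a
      2s+ε≤a = ≤-trans (+-monoʳ-≤ (s + s) ε≤1) (x≤x+y _ (inj₁ 0<δ))
      increment : (s + s + ε) * ε ≤ δ
      increment = subst ((s + s + ε) * ε ≤_) (trans (*-comm a ε) εa≡δ) (*-monoˡ-≤ (inj₁ 0<ε) 2s+ε≤a)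
      [s+ε]²≤x : (s + ε) * (s + ε) ≤ x
      [s+ε]²≤x = subst₂ _≤_
        (solve 2 (λ u e → u :* u :+ (u :+ u :+ e) :* e := (u :+ e) :* (u :+ e)) refl s ε)
        s²+δ≡x (+-monoʳ-≤ (s * s) increment)

    s²≯x : ¬ x < s * s
    s²≯x x<s² with δ , 0<δ , x+δ≡s² ← <⇒gap x<s² = <⇒≱ t<s (least t t-upper)
      where
      0<s : 0# < s
      0<s with 0≤s
      ... | inj₁ 0<s = 0<s
      ... | inj₂ 0≡s = contradiction (subst (x <_) (trans (cong₂ _*_ (sym 0≡s) (sym 0≡s)) (zeroˡ 0#)) x<s²) (λ x<0 → <⇒≱ x<0 0≤x)
      0<2s : 0# < s + s
      0<2s = <-trans 0<s (x<x+y s 0<s)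
      quotient = divide 0<δ 0<2s
      ε = proj₁ quotient
      0<ε = proj₁ (proj₂ quotient)
      ε2s≡δ : ε * (s + s) ≡ δ
      ε2s≡δ = proj₂ (proj₂ quotient)
      δ≤s² : δ ≤ s * s
      δ≤s² = subst (δ ≤_) (trans (+-comm δ x) x+δ≡s²) (x≤x+y δ 0≤x)
      ε≯s : ¬ s < ε
      ε≯s s<ε = <⇒≱ (<-trans (x<x+y (s * s) (*-pos 0<s 0<s))
        (subst₂ _<_ (solve 1 (λ u → u :* (u :+ u) := u :* u :+ u :* u) refl s) ε2s≡δ (*-monoˡ-< 0<2s s<ε))) δ≤s²
      t = s - ε
      t+ε≡s : t + ε ≡ s
      t+ε≡s = trans (+-assoc s (- ε) ε) (trans (cong (s +_) (-‿inverseˡ ε)) (+-identityʳ s))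
      t<s : t < s
      t<s = subst (t <_) t+ε≡s (x<x+y t 0<ε)
      0≤t : 0# ≤ t
      0≤t = ≮⇒≥ λ t<0 → ε≯s (subst₂ _<_ t+ε≡s (+-identityˡ ε) (+-monoˡ-< ε t<0))
      t²≡x+ε² : t * t ≡ x + ε * ε
      t²≡x+ε² = +-cancelʳ (t * ε + t * ε + ε * ε) _ _ (trans
        (solve 2 (λ u e → u :* u :+ (u :* e :+ u :* e :+ e :* e) := (u :+ e) :* (u :+ e)) refl t ε)
        (trans (cong₂ _*_ t+ε≡s t+ε≡s) (trans (sym x+δ≡s²) (trans (cong (x +_) (trans (sym ε2s≡δ)
        (cong (λ u → ε * (u + u)) (sym t+ε≡s))))
        (solve 3 (λ x u e → x :+ e :* ((u :+ e) :+ (u :+ e)) := x :+ e :* e :+ (u :* e :+ u :* e :+ e :* e)) refl x t ε)))))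
      x≤t² : x ≤ t * t
      x≤t² = subst (x ≤_) (sym t²≡x+ε²) (x≤x+y x (square-nonNeg ε))
      t-upper : ∀ y → 0# ≤ y × y * y ≤ x → y ≤ t
      t-upper y (_ , y²≤x) = ≮⇒≥ λ t<y → <⇒≱ (≤-<-trans x≤t² (square-mono-< 0≤t t<y)) y²≤x

    s²≡x : s * s ≡ x
    s²≡x with compare (s * s) x
    ... | tri< s²<x _ _ = contradiction s²<x s²≮x
    ... | tri≈ _ s²≡x _ = s²≡x
    ... | tri> _ _ x<s² = contradiction x<s² s²≯x

------------------------------------------------------------------------
-- Graphs on the vertex set Fin n

-- An undirected edge, stored with an arbitrary orientation.
Edge : ℕ → Set
Edge n = Fin n × Fin n

-- Read as the edge set of a graph: order and orientation are irrelevant.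
Edges : ℕ → Set
Edges n = List (Edge n)

Adjacent : ∀ {n} → Edges n → Fin n → Fin n → Set
Adjacent E u v = (u , v) ∈ E ⊎ (v , u) ∈ E

SameEdges : ∀ {n} → Edges n → Edges n → Set
SameEdges E F = ∀ u v → Adjacent E u v ⇔ Adjacent F u v

-- The number of entries of E incident with v; this is the degree of v
-- because the edge lists built below have no repetitions.
degree : ∀ {n} → Edges n → Fin n → ℕ
degree E v = length (filter (λ e → (proj₁ e Fin.≟ v) ⊎-dec (proj₂ e Fin.≟ v)) E)

pathEdges : ∀ {n} → List (Fin n) → Edges n
pathEdges (u ∷ v ∷ vs) = (u , v) ∷ pathEdges (v ∷ vs)
pathEdges _            = []

cycleEdges : ∀ {n} → List (Fin n) → Edges n
cycleEdges []       = []
cycleEdges (v ∷ vs) = pathEdges (v ∷ vs ++ [ v ])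

-- c lists the vertices of a cycle in cyclic order.
IsCycle : ∀ {n} → List (Fin n) → Set
IsCycle c = 3 ℕ.≤ length c × Unique c

_⊆ᴱ_ : ∀ {n} → Edges n → Edges n → Set
F ⊆ᴱ E = All (λ e → Adjacent E (proj₁ e) (proj₂ e)) F

Hamiltonian : ∀ {n} → List (Fin n) → Set
Hamiltonian {n} vs = vs ↭ allFin n

IsTour : ∀ {n} → Edges n → Set
IsTour E = ∃[ c ] IsCycle c × Hamiltonian c × SameEdges E (cycleEdges c)

-- e can be added to E without repeating an edge and without creating a
-- vertex of degree 3 or a non-Hamilton cycle.
Admissible : ∀ {n} → Edges n → Edge n → Set
Admissible E e@(u , v) =
    u ≢ v
  × ¬ Adjacent E u v
  × (∀ w → degree (e ∷ E) w ≢ 3)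
  × (∀ c → IsCycle c → cycleEdges c ⊆ᴱ (e ∷ E) → Hamiltonian c)

------------------------------------------------------------------------
-- Programs with a blackbox for comparing sums of distances.
--
-- A first-order Lisp: values are binary trees and a program is a finite
-- system of mutually recursive functions.  With values stored as shared
-- acyclic graphs, each evaluation rule other than an oracle query takes
-- constant time, and a query is charged the number of distances summed,
-- so the cost below agrees with (oracle) Turing machine time up to a
-- polynomial.

data Tree : Set where
  nil : Tree
  _∙_ : Tree → Tree → Tree

data Term {K} (arity : Fin K → ℕ) (Γ : ℕ) : Set where
  var  : Fin Γ → Term arity Γ
  nil  : Term arity Γ
  cons : Term arity Γ → Term arity Γ → Term arity Γ
  -- The last branch binds the left (index 0) and right (index 1) subtrees.
  case : Term arity Γ → Term arity Γ → Term arity (2 ℕ.+ Γ) → Term arity Γ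
  call : (f : Fin K) → Vec (Term arity Γ) (arity f) → Term arity Γ
  -- less a b asks whether the sum of the distances listed by a is
  -- smaller than the sum of those listed by b.
  less : Term arity Γ → Term arity Γ → Term arity Γ

record Program : Set where
  field
    size  : ℕ
    arity : Fin size → ℕ
    body  : ∀ f → Term arity (arity f)
    main  : Term arity 1

encodeℕ : ℕ → Tree
encodeℕ zero    = nil
encodeℕ (suc n) = nil ∙ encodeℕ n

encodeList : ∀ {A : Set} → (A → Tree) → List A → Tree
encodeList enc []       = nil
encodeList enc (x ∷ xs) = enc x ∙ encodeList enc xs

encodeFin : ∀ {m} → Fin m → Tree
encodeFin i = encodeℕ (toℕ i)

encodeEdge : ∀ {m} → Edge m → Tree
encodeEdge (i , j) = encodeFin i ∙ encodeFin j

module Semantics (𝕣 : Reals) (P : Program) {m} (δ : Fin m → Fin m → Reals.ℝ 𝕣) where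
  open Reals 𝕣
  open Program P

  total : Edges m → ℝ
  total = foldr (λ (i , j) s → δ i j + s) 0#

  mutual
    -- ρ ⊢ e ⇓ v # t: in environment ρ the term e evaluates to v in time t.
    data _⊢_⇓_#_ {Γ} (ρ : Vec Tree Γ) : Term arity Γ → Tree → ℕ → Set where
      var : ∀ x → ρ ⊢ var x ⇓ Vec.lookup ρ x # 1
      nil : ρ ⊢ nil ⇓ nil # 1
      cons : ∀ {a b u v s t} → ρ ⊢ a ⇓ u # s → ρ ⊢ b ⇓ v # t →
             ρ ⊢ cons a b ⇓ u ∙ v # suc (s ℕ.+ t)
      case-nil : ∀ {a b c v s t} → ρ ⊢ a ⇓ nil # s → ρ ⊢ b ⇓ v # t →
                 ρ ⊢ case a b c ⇓ v # suc (s ℕ.+ t)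
      case-cons : ∀ {a b c l r v s t} → ρ ⊢ a ⇓ l ∙ r # s → (l ∷ r ∷ ρ) ⊢ c ⇓ v # t →
                  ρ ⊢ case a b c ⇓ v # suc (s ℕ.+ t)
      call : ∀ {f as us v s t} → ρ ⊢* as ⇓ us # s → us ⊢ body f ⇓ v # t →
             ρ ⊢ call f as ⇓ v # suc (s ℕ.+ t)
      less-yes : ∀ {a b s t} A B →
                 ρ ⊢ a ⇓ encodeList encodeEdge A # s → ρ ⊢ b ⇓ encodeList encodeEdge B # t →
                 total A < total B →
                 ρ ⊢ less a b ⇓ nil ∙ nil # suc (length A ℕ.+ length B ℕ.+ (s ℕ.+ t))
      less-no : ∀ {a b s t} A B →
                ρ ⊢ a ⇓ encodeList encodeEdge A # s → ρ ⊢ b ⇓ encodeList encodeEdge B # t →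
                ¬ total A < total B →
                ρ ⊢ less a b ⇓ nil # suc (length A ℕ.+ length B ℕ.+ (s ℕ.+ t))

    data _⊢*_⇓_#_ {Γ} (ρ : Vec Tree Γ) : ∀ {k} → Vec (Term arity Γ) k → Vec Tree k → ℕ → Set where
      []  : ρ ⊢* [] ⇓ [] # 0
      _∷_ : ∀ {k a u s t} {as : Vec (Term arity Γ) k} {us} → ρ ⊢ a ⇓ u # s → ρ ⊢* as ⇓ us # t →
            ρ ⊢* (a ∷ as) ⇓ (u ∷ us) # (s ℕ.+ t)

  -- On input m in unary, with δ behind the oracle, the program outputs
  -- the list L of vertex sequences in time t.
  Outputs : List (List (Fin m)) → ℕ → Set
  Outputs L t = (encodeℕ m ∷ []) ⊢ main ⇓ encodeList (encodeList encodeFin) L # t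

------------------------------------------------------------------------
-- Euclidean point sets and the travelling salesman problem

module Euclidean (𝕣 : Reals) (d : ℕ) where
  open Reals 𝕣
  open SquareRoot 𝕣 using (+-nonNeg; square-nonNeg; sqrt)

  Point : Set
  Point = Vec ℝ d

  sumOfSquares : ∀ {k} → Vec ℝ k → ℝ
  sumOfSquares = Vec.foldr _ (λ x s → x * x + s) 0#

  sumOfSquares-nonNeg : ∀ {k} (x : Vec ℝ k) → 0# ≤ sumOfSquares x
  sumOfSquares-nonNeg []       = inj₂ refl
  sumOfSquares-nonNeg (x ∷ xs) = +-nonNeg (square-nonNeg x) (sumOfSquares-nonNeg xs)

  norm : Point → ℝ
  norm x = proj₁ (sqrt (sumOfSquares x) (sumOfSquares-nonNeg x))

  dist : Point → Point → ℝ
  dist x y = norm (Vec.zipWith _-_ x y)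

  distances : ∀ {m} → (Fin m → Point) → Fin m → Fin m → ℝ
  distances Y i j = dist (Y i) (Y j)

  -- The pairs i < j, indexing the distances d₁, …, d_(m choose 2).
  pairs : ∀ m → Edges m
  pairs m = filter (λ (i , j) → i Fin.<? j) (cartesianProduct (allFin m) (allFin m))

  GeneralPosition : ∀ {m} → (Fin m → Point) → Set
  GeneralPosition {m} Y =
    (ξ : Edge m → ℝ) → (∀ e → ξ e ≡ 0# ⊎ ξ e ≡ 1# ⊎ ξ e ≡ - 1#) →
    (∃[ e ] e ∈ pairs m × ξ e ≢ 0#) →
    foldr (λ e s → ξ e * distances Y (proj₁ e) (proj₂ e) + s) 0# (pairs m) ≢ 0#

  Ball : Point → ℝ → Point → Set
  Ball p r x = dist x p ≤ r

  -- A matching of Y with Z that makes them congruent.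
  Congruence : ∀ {m n} → (Fin m → Point) → (Fin n → Point) → Set
  Congruence {m} {n} Y Z =
    Σ (Fin m ⤖ Fin n) λ φ → ∀ i j → distances Y i j ≡ distances Z (Bijection.to φ i) (Bijection.to φ j)

  record PathFindingHeuristic : Set where
    field
      program : Program
      -- The running time on m points is at most c · mᵏ + c.
      c k     : ℕ
    open Semantics 𝕣 program public using (Outputs)
    field
      correct : ∀ {m} (Y : Fin m → Point) → GeneralPosition Y →
                ∃[ L ] ∃[ t ] Outputs (distances Y) L t × t ℕ.≤ c ℕ.* m ℕ.^ k ℕ.+ c × All Hamiltonian L

  -- A heuristic is a relation, to allow for unspecified behaviour:
  -- Produces X E says that E is a possible outcome on input X.
  record TSPHeuristic : Set₁ where
    field
      Produces : ∀ {n} → (Fin n → Point) → Edges n → Set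
      tour     : ∀ {n} {X : Fin n → Point} {E} → Produces X E → IsTour E

  -- B(p,1) ∩ X, as a list of indices.
  cluster : ∀ {n} → (Fin n → Point) → Point → List (Fin n)
  cluster X p = filter (λ i → dist (X i) p ≤? 1#) (allFin _)

  clusterPoints : ∀ {n} (X : Fin n → Point) p → Fin (length (cluster X p)) → Point
  clusterPoints X p k = X (List.lookup (cluster X p) k)

  -- The edges E form a tour on which the vertices in S are visited in a
  -- path Q: Q runs through S exactly and uses only edges of E.
  TraversesIn : ∀ {n} → Edges n → List (Fin n) → List (Fin n) → Set
  TraversesIn E S Q = Q ↭ S × pathEdges Q ⊆ᴱ E

  -- Paths are undirected, so two vertex sequences through the same
  -- points are the same path when they have the same edges.
  SamePath : ∀ {n} → List (Fin n) → List (Fin n) → Set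
  SamePath Q Q′ = SameEdges (pathEdges Q) (pathEdges Q′)

  Scalefree : TSPHeuristic → Set
  Scalefree H =
    ∃[ R ] Σ PathFindingHeuristic λ A →
    ∀ {n} (X : Fin n → Point) → Injective _≡_ _≡_ X →
    ∀ E → TSPHeuristic.Produces H X E →
    ∀ p →
    (∀ i → ¬ (Ball p R (X i) × ¬ Ball p 1# (X i))) →
    GeneralPosition (clusterPoints X p) →
    ∃[ Q ] TraversesIn E (cluster X p) Q ×
      (∀ {m} (Y : Fin m → Point) (congruence : Congruence Y (clusterPoints X p)) →
       let φ = Bijection.to (proj₁ congruence) in
       ∃[ L ] ∃[ t ] PathFindingHeuristic.Outputs A (distances Y) L t ×
       ∃[ π ] π ∈ L × SamePath (map (λ i → List.lookup (cluster X p) (φ i)) π) Q)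

  module _ {n} (X : Fin n → Point) where

    edgeLength : Edge n → ℝ
    edgeLength (u , v) = dist (X u) (X v)

    -- The edge sets that can arise after finitely many steps, for some
    -- way of breaking ties.
    data GreedyState : Edges n → Set where
      start : GreedyState []
      add   : ∀ {E} e → GreedyState E → Admissible E e →
              (∀ e′ → Admissible E e′ → edgeLength e ≤ edgeLength e′) →
              GreedyState (e ∷ E)

  Greedy : TSPHeuristic
  Greedy = record
    { Produces = λ X E → GreedyState X E × IsTour E
    ; tour     = proj₂
    }

open Euclidean public using (Scalefree; Greedy)

{-# OPTIONS --safe #-}

-- Take R = 4.  By |x - y|² ≤ 2|x - z|² + 2|y - z|² all distances inside
-- S = B(p,1) ∩ X are at most 2, whereas edges leaving S are longer.  As
-- long as Greedy has not joined S to a single path, its edges in S form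
-- disjoint paths that exhaust S and no edge leaves S; hence the shortest
-- edge joining ends of two of these paths is admissible.  So Greedy adds
-- no crossing edge, and the edges it adds inside S are exactly these
-- shortest joining edges, which are unique by general position.  The
-- path-finding heuristic performs this repeated joining and outputs the
-- resulting path.
module Submission where

open import Defs
open import Algebra.Bundles using (CommutativeRing)
import Algebra.Properties.Ring as RingProperties
import Algebra.Solver.Ring.NaturalCoefficients.Default as SemiringSolver
open import Data.Empty using (⊥; ⊥-elim)
open import Data.Fin as Fin using (Fin; zero; suc; toℕ; fromℕ<)
open import Data.Fin.Patterns using (0F; 1F; 2F; 3F; 4F; 5F; 6F; 7F; 8F; 9F)
import Data.Fin.Properties as Finₚ
open import Data.List using (List; []; _∷_; [_]; _++_; _∷ʳ_; length; map; foldr; filter; lookup; reverse; concat; allFin)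
open import Data.List.Membership.Propositional using (_∈_; _∉_)
open import Data.List.Membership.Propositional.Properties
  using (∈-++⁺ˡ; ∈-++⁺ʳ; ∈-++⁻; ∈-∃++; ∈-allFin; ∈-cartesianProduct⁺; ∈-concat⁺; ∈-concat⁻; ∈-filter⁺; ∈-filter⁻; ∈-map⁺)
open import Data.List.Membership.Propositional.Properties.WithK using (unique∧set⇒bag)
open import Data.List.Properties
  using (++-assoc; ++-identityʳ; concat-map-[_]; filter-accept; filter-reject; length-++; length-map; length-reverse; map-++
        ; map-tabulate; map-∘; reverse-++; reverse-involutive; reverse-map; tabulate-lookup; unfold-reverse)
open import Data.List.Relation.Binary.BagAndSetEquality using (∼bag⇒↭)
open import Data.List.Relation.Binary.Permutation.Propositional as Perm
  using (_↭_; ↭-refl; ↭-trans; ↭-sym; ↭-reflexive)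
open import Data.List.Relation.Binary.Permutation.Propositional.Properties
  using (++⁺ˡ; ++⁺ʳ; map⁺; shifts; ↭-reverse; ↭-length; ∈-resp-↭; All-resp-↭) renaming (++-comm to ↭-++-comm)
open import Data.List.Relation.Unary.All as All using (All; []; _∷_)
import Data.List.Relation.Unary.All.Properties as Allₚ
open import Data.List.Relation.Unary.AllPairs using ([]; _∷_)
open import Data.List.Relation.Unary.Any as Any using (Any; here; there; index)
open import Data.List.Relation.Unary.Any.Properties using (reverse⁺; reverse⁻; lookup-index)
open import Data.List.Relation.Unary.Unique.Propositional using (Unique)
import Data.List.Relation.Unary.Unique.Propositional.Properties as Uniqueₚ
open import Data.Nat as ℕ using (ℕ; zero; suc; z≤n; s≤s)
import Data.Nat.Properties as ℕₚ
open import Data.Nat.Tactic.RingSolver using (solve-∀)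
open import Data.Product using (∃-syntax; _×_; _,_; proj₁; proj₂)
open import Data.Product.Properties using (≡-dec)
open import Data.Sum as Sum using (_⊎_; inj₁; inj₂; [_,_]′)
open import Data.Vec using (Vec; []; _∷_)
import Data.Vec as Vec
open import Function.Bundles using (mk⇔; module Bijection; module Equivalence)
open import Function.Construct.Identity using (⤖-id)
open import Relation.Binary.Definitions using (tri<; tri≈; tri>)
open import Relation.Binary.PropositionalEquality using (_≡_; _≢_; refl; sym; trans; cong; cong₂; subst; subst₂)
open import Relation.Nullary using (¬_; contradiction; Dec; yes; no)
open import Relation.Nullary.Decidable using (_⊎-dec_)

-- Repeated joining of paths

-- Every congruent copy of S must lead to the same path `Q`, although its points may be listed in
-- any order. The algorithm is therefore specified by the nondeterministic relation `Merges`, which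
-- ignores how paths are ordered and oriented and can be carried along a congruence. The program is
-- shown to realise it, and any two realisations are shown to follow the same run of Greedy. `Q`
-- itself is the output on S, taken as a copy of itself. The constant 4 comes from using squared
-- distances only: the quoted inequality holds coordinate by coordinate, whereas the triangle
-- inequality would require Cauchy-Schwarz. If an edge from x in S to y outside S were no longer
-- than some edge inside S, its square would be at most 4, and |y - p|² ≤ 2(4 + 1) = 10 < 16 would
-- contradict |y - p| > 4. Both the admissibility of a joining edge and the impossibility of a tour
-- while S is still in pieces rest on one fact: if the edges meeting a vertex set form disjoint
-- paths on that set, no cycle passes through it.

infix 4 _≈_
-- Equality of families of undirected paths. Reversal is included so that a joining edge can always
-- be placed between the last vertex of the first path and the first vertex of the second.
data _≈_ {A : Set} : List (List A) → List (List A) → Set where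
  ≈-refl  : ∀ {ps} → ps ≈ ps
  ≈-trans : ∀ {ps qs rs} → ps ≈ qs → qs ≈ rs → ps ≈ rs
  prep    : ∀ P {ps qs} → ps ≈ qs → P ∷ ps ≈ P ∷ qs
  swap    : ∀ P Q {ps} → P ∷ Q ∷ ps ≈ Q ∷ P ∷ ps
  flip    : ∀ P {ps} → P ∷ ps ≈ reverse P ∷ ps

≈-reflexive : ∀ {A : Set} {ps qs : List (List A)} → ps ≡ qs → ps ≈ qs
≈-reflexive refl = ≈-refl

≈-length : ∀ {A : Set} {ps qs : List (List A)} → ps ≈ qs → length ps ≡ length qs
≈-length ≈-refl        = refl
≈-length (≈-trans r s) = trans (≈-length r) (≈-length s)
≈-length (prep P r)    = cong suc (≈-length r)
≈-length (swap P Q)    = refl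
≈-length (flip P)      = refl

≈-concat : ∀ {A : Set} {ps qs : List (List A)} → ps ≈ qs → concat ps ↭ concat qs
≈-concat ≈-refl            = ↭-refl
≈-concat (≈-trans r s)     = ↭-trans (≈-concat r) (≈-concat s)
≈-concat (prep P r)        = ++⁺ˡ P (≈-concat r)
≈-concat (swap P Q)        = shifts P Q
≈-concat (flip P {ps})     = ++⁺ʳ (concat ps) (↭-sym (↭-reverse P))

≈-map : ∀ {A B : Set} (f : A → B) {ps qs} → ps ≈ qs → map (map f) ps ≈ map (map f) qs
≈-map f ≈-refl         = ≈-refl
≈-map f (≈-trans r s)  = ≈-trans (≈-map f r) (≈-map f s)
≈-map f (prep P r)     = prep (map f P) (≈-map f r)
≈-map f (swap P Q)     = swap (map f P) (map f Q)
≈-map f (flip P {ps})  = ≈-trans (flip (map f P)) (≈-reflexive (cong (_∷ map (map f) ps) (sym (reverse-map f P))))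

Starts : ∀ {A : Set} → A → List A → Set
Starts x P = ∃[ xs ] P ≡ x ∷ xs

IsEnd : ∀ {A : Set} → A → List A → Set
IsEnd x P = Starts x P ⊎ Starts x (reverse P)

-- Only the orientation with `x` on the earlier path is listed; the other one is recovered from the
-- symmetry of distances.
data Candidate {A : Set} : List (List A) → A → A → Set where
  here  : ∀ {P ps x y} → IsEnd x P → Any (IsEnd y) ps → Candidate (P ∷ ps) x y
  there : ∀ {P ps x y} → Candidate ps x y → Candidate (P ∷ ps) x y

module _ {A B : Set} (f : A → B) where

  Starts-map : ∀ {x P} → Starts x P → Starts (f x) (map f P)
  Starts-map (xs , refl) = map f xs , refl

  Starts-map⁻ : ∀ P {y} → Starts y (map f P) → ∃[ x ] f x ≡ y × Starts x P
  Starts-map⁻ (x ∷ P) (_ , refl) = x , refl , P , refl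

  IsEnd-map⁻ : ∀ P {y} → IsEnd y (map f P) → ∃[ x ] f x ≡ y × IsEnd x P
  IsEnd-map⁻ P (inj₁ s) with x , eq , s′ ← Starts-map⁻ P s = x , eq , inj₁ s′
  IsEnd-map⁻ P {y} (inj₂ s)
    with x , eq , s′ ← Starts-map⁻ (reverse P) (subst (Starts y) (sym (reverse-map f P)) s) = x , eq , inj₂ s′

  AnyEnd-map⁻ : ∀ ps {y} → Any (IsEnd y) (map (map f) ps) → ∃[ x ] f x ≡ y × Any (IsEnd x) ps
  AnyEnd-map⁻ (P ∷ ps) (here e)  with x , eq , e′ ← IsEnd-map⁻ P e   = x , eq , here e′
  AnyEnd-map⁻ (P ∷ ps) (there i) with x , eq , i′ ← AnyEnd-map⁻ ps i = x , eq , there i′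

  -- Minimality in the image family quantifies over the candidates of the image, so these have to be
  -- pulled back.
  Candidate-map⁻ : ∀ ps {y z} → Candidate (map (map f) ps) y z →
                   ∃[ u ] ∃[ v ] f u ≡ y × f v ≡ z × Candidate ps u v
  Candidate-map⁻ (P ∷ ps) (here e i)
    with u , eq , e′ ← IsEnd-map⁻ P e | v , eq′ , i′ ← AnyEnd-map⁻ ps i = u , v , eq , eq′ , here e′ i′
  Candidate-map⁻ (P ∷ ps) (there c)
    with u , v , eq , eq′ , c′ ← Candidate-map⁻ ps c = u , v , eq , eq′ , there c′

module Merging (𝕣 : Reals) where
  open Reals 𝕣

  -- R arises from ps by always joining two paths by a shortest edge
  -- between their ends.
  data Merges {A : Set} (w : A → A → ℝ) : List (List A) → List A → Set where
    none  : Merges w [] []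
    single : ∀ {P} → Merges w (P ∷ []) P
    merge : ∀ {ps P Q rest u v R} → ps ≈ P ∷ Q ∷ rest → Starts u (reverse P) → Starts v Q →
            (∀ {x y} → Candidate ps x y → w u v ≤ w x y) →
            Merges w ((P ++ Q) ∷ rest) R → Merges w ps R

  -- Used to read a run on a congruent copy as a run on the original vertices.
  Merges-map : ∀ {A B : Set} {w : A → A → ℝ} {w′ : B → B → ℝ} (f : A → B) →
               (∀ x y → w x y ≡ w′ (f x) (f y)) →
               ∀ {ps R} → Merges w ps R → Merges w′ (map (map f) ps) (map f R)
  Merges-map f w≡w′ none = none
  Merges-map f w≡w′ single = single
  Merges-map {w′ = w′} f w≡w′ {ps} (merge {P = P} {Q} {rest} {u} {v} r su sv shortest c) =
    merge (≈-map f r)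
      (subst (Starts (f u)) (reverse-map f P) (Starts-map f su)) (Starts-map f sv)
      (λ c → let x , y , fx , fy , c′ = Candidate-map⁻ f ps c
             in subst₂ _≤_ (w≡w′ u v) (trans (w≡w′ x y) (cong₂ w′ fx fy)) (shortest c′))
      (subst (λ P → Merges w′ (P ∷ map (map f) rest) _) (map-++ f P Q) (Merges-map f w≡w′ c))

  Merges-concat : ∀ {A : Set} {w : A → A → ℝ} {ps R} → Merges w ps R → R ↭ concat ps
  Merges-concat none = ↭-refl
  Merges-concat {ps = P ∷ []} single = ↭-reflexive (sym (++-identityʳ P))
  Merges-concat (merge {P = P} {Q} {rest} r su sv shortest c) =
    ↭-trans (Merges-concat c) (↭-trans (↭-reflexive (++-assoc P Q (concat rest))) (↭-sym (≈-concat r)))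

-- A path stored with its reversal, so that the program never has to
-- reverse a list or search for its last element.
record Route (A : Set) : Set where
  field
    first  : A
    others : List A
    final  : A
    before : List A
    mirror : reverse (first ∷ others) ≡ final ∷ before

  forward backward : List A
  forward  = first ∷ others
  backward = final ∷ before

open Route

opposite : ∀ {A} → Route A → Route A
opposite p = record
  { first = final p ; others = before p ; final = first p ; before = others p
  ; mirror = trans (cong reverse (sym (mirror p))) (reverse-involutive (forward p)) }

join : ∀ {A} → Route A → Route A → Route A
join p q = record
  { first = first p ; others = others p ++ forward q ; final = final q ; before = before q ++ backward p
  ; mirror = trans (reverse-++ (forward p) (forward q)) (cong₂ _++_ (mirror q) (mirror p)) }

trivial : ∀ {A} → A → Route A
trivial x = record { first = x ; others = [] ; final = x ; before = [] ; mirror = refl }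

-- Two routes to be joined by the edge from the end of the first to the
-- start of the second, and the remaining routes.
record Plan (A : Set) : Set where
  constructor plan
  field
    one two : Route A
    rest    : List (Route A)

  routes : List (Route A)
  routes = one ∷ two ∷ rest

open Plan

keep : ∀ {A} → Route A → Plan A → Plan A
keep p (plan a b r) = plan a b (p ∷ r)

forwards : ∀ {A} → List (Route A) → List (List A)
forwards = map forward

-- Choosing a shortest joining edge

module Selection (𝕣 : Reals) {A : Set} (w : A → A → Reals.ℝ 𝕣) where
  open Reals 𝕣
  open Merging 𝕣
  open CommutativeRing commutativeRing using () renaming (+-identityʳ to x+0≡x)
  open SquareRoot 𝕣 using (≮⇒≥)

  gap : Plan A → ℝ
  gap c = w (final (one c)) (first (two c))

  -- The summand 0# matches the sums formed by the oracle.
  shorter : Plan A → Plan A → Plan A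
  shorter c d with (gap c + 0#) <? (gap d + 0#)
  ... | yes _ = c
  ... | no  _ = d

  -- A gap is always measured from `final` to `first`; the four possible edges between ends of two
  -- paths arise by reversing neither, one or both of them.
  orient : Route A → Route A → List (Route A) → Plan A
  orient p q r = shorter (shorter (plan p q r) (plan p (opposite q) r))
                         (shorter (plan (opposite p) q r) (plan (opposite p) (opposite q) r))

  -- `bestWith` and `best` copy the recursion of the program functions of the same name, so that the
  -- evaluation derivations follow them clause by clause. A route left out of the recursive call is
  -- put back by `keep`, because a plan must still contain all routes.
  bestWith : Route A → Route A → List (Route A) → Plan A
  bestWith p q []        = orient p q []
  bestWith p q (q′ ∷ qs) = shorter (orient p q (q′ ∷ qs)) (keep q (bestWith p q′ qs))

  best : Route A → Route A → List (Route A) → Plan A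
  best p q []       = bestWith p q []
  best p q (r ∷ rs) = shorter (bestWith p q (r ∷ rs)) (keep p (best q r rs))

  shorter-elim : (C : Plan A → Set) → ∀ c d → C c → C d → C (shorter c d)
  shorter-elim C c d cc cd with (gap c + 0#) <? (gap d + 0#)
  ... | yes _ = cc
  ... | no  _ = cd

  shorter≤ : ∀ c d → gap (shorter c d) ≤ gap c × gap (shorter c d) ≤ gap d
  shorter≤ c d with (gap c + 0#) <? (gap d + 0#)
  ... | yes c<d = inj₂ refl , inj₁ (subst₂ _<_ (x+0≡x _) (x+0≡x _) c<d)
  ... | no  c≮d = subst₂ _≤_ (x+0≡x _) (x+0≡x _) (≮⇒≥ c≮d) , inj₂ refl

  shorter≤ˡ : ∀ c d {x} → gap c ≤ x → gap (shorter c d) ≤ x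
  shorter≤ˡ c d = ≤-trans (proj₁ (shorter≤ c d))

  shorter≤ʳ : ∀ c d {x} → gap d ≤ x → gap (shorter c d) ≤ x
  shorter≤ʳ c d = ≤-trans (proj₂ (shorter≤ c d))

  keep-≈ : ∀ (p q : Route A) rs {c} → forwards (q ∷ rs) ≈ forwards (routes c) →
           forwards (p ∷ q ∷ rs) ≈ forwards (routes (keep p c))
  keep-≈ p q rs r = ≈-trans (prep _ r) (≈-trans (swap _ _) (prep _ (swap _ _)))

  opposite-≈ : ∀ (p : Route A) {ps} → forward p ∷ ps ≈ forward (opposite p) ∷ ps
  opposite-≈ p {ps} = ≈-trans (flip _) (≈-reflexive (cong (_∷ ps) (mirror p)))

  orient-≈ : ∀ (p q : Route A) r → forwards (p ∷ q ∷ r) ≈ forwards (routes (orient p q r))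
  orient-≈ p q r =
    elim (shorter (plan p q r) (plan p (opposite q) r))
         (shorter (plan (opposite p) q r) (plan (opposite p) (opposite q) r))
      (elim (plan p q r) (plan p (opposite q) r) ≈-refl flipʳ)
      (elim (plan (opposite p) q r) (plan (opposite p) (opposite q) r)
        (opposite-≈ p) (≈-trans flipʳ (opposite-≈ p)))
    where
    elim = shorter-elim (λ c → forwards (p ∷ q ∷ r) ≈ forwards (routes c))
    flipʳ : forwards (p ∷ q ∷ r) ≈ forwards (p ∷ opposite q ∷ r)
    flipʳ = prep _ (opposite-≈ q)

  bestWith-≈ : ∀ p q rs → forwards (p ∷ q ∷ rs) ≈ forwards (routes (bestWith p q rs))
  bestWith-≈ p q []        = orient-≈ p q []
  bestWith-≈ p q (q′ ∷ qs) =
    shorter-elim (λ c → forwards (p ∷ q ∷ q′ ∷ qs) ≈ forwards (routes c)) (orient p q (q′ ∷ qs)) (keep q (bestWith p q′ qs))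
    (orient-≈ p q (q′ ∷ qs))
    (≈-trans (swap _ _) (keep-≈ q p (q′ ∷ qs) {bestWith p q′ qs} (bestWith-≈ p q′ qs)))

  best-≈ : ∀ p q rs → forwards (p ∷ q ∷ rs) ≈ forwards (routes (best p q rs))
  best-≈ p q []       = bestWith-≈ p q []
  best-≈ p q (r ∷ rs) =
    shorter-elim (λ c → forwards (p ∷ q ∷ r ∷ rs) ≈ forwards (routes c)) (bestWith p q (r ∷ rs)) (keep p (best q r rs))
    (bestWith-≈ p q (r ∷ rs)) (keep-≈ p q (r ∷ rs) {best q r rs} (best-≈ q r rs))

  end-cases : ∀ (p : Route A) {x} → IsEnd x (forward p) → x ≡ first p ⊎ x ≡ final p
  end-cases p (inj₁ (_ , refl)) = inj₁ refl
  end-cases p (inj₂ (_ , eq)) with refl ← trans (sym (mirror p)) eq = inj₂ refl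

  orient≤ : ∀ (p q : Route A) r {x y} → IsEnd x (forward p) → IsEnd y (forward q) → gap (orient p q r) ≤ w x y
  orient≤ p q r ex ey with end-cases p ex | end-cases q ey
  ... | inj₂ refl | inj₁ refl = shorter≤ˡ _ _ (shorter≤ˡ (plan p q r) _ (inj₂ refl))
  ... | inj₂ refl | inj₂ refl = shorter≤ˡ _ _ (shorter≤ʳ _ (plan p (opposite q) r) (inj₂ refl))
  ... | inj₁ refl | inj₁ refl = shorter≤ʳ _ _ (shorter≤ˡ (plan (opposite p) q r) _ (inj₂ refl))
  ... | inj₁ refl | inj₂ refl = shorter≤ʳ _ _ (shorter≤ʳ _ (plan (opposite p) (opposite q) r) (inj₂ refl))

  bestWith≤ : ∀ (p q : Route A) rs {x y} → IsEnd x (forward p) → Any (IsEnd y) (forwards (q ∷ rs)) →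
              gap (bestWith p q rs) ≤ w x y
  bestWith≤ p q []        ex (here ey)  = orient≤ p q [] ex ey
  bestWith≤ p q (q′ ∷ qs) ex (here ey)  = shorter≤ˡ _ _ (orient≤ p q (q′ ∷ qs) ex ey)
  bestWith≤ p q (q′ ∷ qs) ex (there ey) = shorter≤ʳ (orient p q (q′ ∷ qs)) _ (bestWith≤ p q′ qs ex ey)

  best≤ : ∀ (p q : Route A) rs {x y} → Candidate (forwards (p ∷ q ∷ rs)) x y → gap (best p q rs) ≤ w x y
  best≤ p q []       (here ex ey) = bestWith≤ p q [] ex ey
  best≤ p q []       (there (here _ ()))
  best≤ p q []       (there (there ()))
  best≤ p q (r ∷ rs) (here ex ey) = shorter≤ˡ _ _ (bestWith≤ p q (r ∷ rs) ex ey)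
  best≤ p q (r ∷ rs) (there c)    = shorter≤ʳ (bestWith p q (r ∷ rs)) _ (best≤ q r rs c)

  -- One round of the program is one `merge` step.
  merge-best : ∀ p q rs {R} → let c = best p q rs in
               Merges w (forwards (join (one c) (two c) ∷ rest c)) R → Merges w (forwards (p ∷ q ∷ rs)) R
  merge-best p q rs = merge (best-≈ p q rs) (_ , mirror (one (best p q rs))) (_ , refl) (best≤ p q rs)

-- The program

pattern #append     = 0F
pattern #join       = 1F
pattern #gap        = 2F
pattern #shorter    = 3F
pattern #opposite   = 4F
pattern #orient     = 5F
pattern #keep       = 6F
pattern #bestWith   = 7F
pattern #best       = 8F
pattern #solve      = 9F
pattern #singletons = suc 9F

greedyArity : Fin 11 → ℕ
greedyArity = Vec.lookup (2 ∷ 2 ∷ 1 ∷ 2 ∷ 1 ∷ 3 ∷ 2 ∷ 3 ∷ 3 ∷ 2 ∷ 1 ∷ [])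

-- A route is stored as the pair of its two vertex sequences, a plan as
-- the list of its routes.
greedyBody : ∀ f → Term greedyArity (greedyArity f)
greedyBody #append =
  case (var 0F) (var 1F) (cons (var 0F) (call #append (var 1F ∷ var 3F ∷ [])))
greedyBody #join =
  case (var 0F) nil (case (var 3F) nil
    (cons (call #append (var 2F ∷ var 0F ∷ [])) (call #append (var 1F ∷ var 3F ∷ []))))
-- The plan is unfolded down to the head of the backward sequence of the first route and the head of
-- the forward sequence of the second; this pair is the one-element list handed to the oracle.
-- Encoded plans and routes are nonempty, so the `nil` branches are never reached on them.
greedyBody #gap =
  case (var 0F) nil (case (var 1F) nil (case (var 2F) nil (case (var 1F) nil (case (var 4F) nil
    (case (var 0F) nil (cons (cons (var 4F) (var 0F)) nil))))))
greedyBody #shorter =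
  case (less (call #gap (var 0F ∷ [])) (call #gap (var 1F ∷ []))) (var 1F) (var 2F)
greedyBody #opposite =
  case (var 0F) nil (cons (var 1F) (var 0F))
greedyBody #orient =
  call #shorter
    ( call #shorter ( cons (var 0F) (cons (var 1F) (var 2F))
                    ∷ cons (var 0F) (cons (call #opposite (var 1F ∷ [])) (var 2F)) ∷ [])
    ∷ call #shorter ( cons (call #opposite (var 0F ∷ [])) (cons (var 1F) (var 2F))
                    ∷ cons (call #opposite (var 0F ∷ [])) (cons (call #opposite (var 1F ∷ [])) (var 2F)) ∷ [])
    ∷ [])
greedyBody #keep =
  case (var 1F) nil (case (var 1F) nil
    (cons (var 2F) (cons (var 0F) (cons (var 4F) (var 1F)))))
greedyBody #bestWith =
  case (var 2F) (call #orient (var 0F ∷ var 1F ∷ var 2F ∷ []))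
    (call #shorter ( call #orient (var 2F ∷ var 3F ∷ var 4F ∷ [])
                   ∷ call #keep (var 3F ∷ call #bestWith (var 2F ∷ var 0F ∷ var 1F ∷ []) ∷ []) ∷ []))
greedyBody #best =
  case (var 2F) (call #bestWith (var 0F ∷ var 1F ∷ var 2F ∷ []))
    (call #shorter ( call #bestWith (var 2F ∷ var 3F ∷ var 4F ∷ [])
                   ∷ call #keep (var 2F ∷ call #best (var 3F ∷ var 0F ∷ var 1F ∷ []) ∷ []) ∷ []))
greedyBody #solve =
  case (var 1F) (case (var 0F) nil (var 0F))
    (case (call #best (var 2F ∷ var 0F ∷ var 1F ∷ [])) nil (case (var 1F) nil
      (call #solve (call #join (var 2F ∷ var 0F ∷ []) ∷ var 1F ∷ []))))
-- The tail of a unary counter is the code of the next vertex, so the vertices come out in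
-- decreasing order, as in `downFrom`.
greedyBody #singletons =
  case (var 0F) nil
    (cons (cons (cons (var 1F) nil) (cons (var 1F) nil)) (call #singletons (var 1F ∷ [])))

greedyProgram : Program
greedyProgram = record
  { size  = 11
  ; arity = greedyArity
  ; body  = greedyBody
  -- On no points the output is the list whose only entry is the empty path.
  ; main  = case (call #singletons (var 0F ∷ [])) (cons nil nil)
              (cons (call #solve (var 0F ∷ var 1F ∷ [])) nil)
  }

-- Running time bounds

appendTime bestWithTime bestTime singletonsTime : ℕ → ℕ
appendTime l = 3 ℕ.+ l ℕ.* 7
-- Here 176 bounds one `#orient`, so 182 = 6 + 176 covers a scan with a single partner, and 243 = 67
-- + 176 pays for each further partner, 67 being the overhead found in `searchTime`.
bestWithTime l = 182 ℕ.+ l ℕ.* 243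
bestTime zero    = 188
bestTime (suc l) = 67 ℕ.+ (bestWithTime (suc l) ℕ.+ bestTime l)
singletonsTime l = 3 ℕ.+ l ℕ.* 12

roundTime solveTime : ℕ → ℕ
-- One round is a search, bounded by `bestTime-bound`, and two appends that together copy at most
-- `n` vertices at cost 7 each.
roundTime n = 50 ℕ.+ (suc n ℕ.* (500 ℕ.+ n ℕ.* 243) ℕ.+ n ℕ.* 7)
solveTime n = suc n ℕ.* roundTime n

downFrom : ∀ {m} k → k ℕ.≤ m → List (Fin m)
downFrom zero    _   = []
downFrom (suc k) k<m = fromℕ< k<m ∷ downFrom k (ℕₚ.<⇒≤ k<m)

length-downFrom : ∀ {m} k (k≤m : k ℕ.≤ m) → length (downFrom k k≤m) ≡ k
length-downFrom zero    _   = refl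
length-downFrom (suc k) k<m = cong suc (length-downFrom k _)

bestTime-bound : ∀ {l n} → l ℕ.≤ n → bestTime l ℕ.≤ suc l ℕ.* (500 ℕ.+ n ℕ.* 243)
bestTime-bound {zero}  {n} _   = ℕₚ.m≤m+n 188 (312 ℕ.+ n ℕ.* 243 ℕ.+ 0)
bestTime-bound {suc l} {n} l<n = begin
  67 ℕ.+ (182 ℕ.+ suc l ℕ.* 243 ℕ.+ bestTime l)
    ≤⟨ ℕₚ.+-monoʳ-≤ 67 (ℕₚ.+-mono-≤ (ℕₚ.+-monoʳ-≤ 182 (ℕₚ.*-monoˡ-≤ 243 l<n)) (bestTime-bound (ℕₚ.<⇒≤ l<n))) ⟩
  67 ℕ.+ (182 ℕ.+ n ℕ.* 243 ℕ.+ tail)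
    -- 251 = 500 - 67 - 182, where 500 is a round value that also exceeds the base case 188.
    ≤⟨ ℕₚ.m≤m+n _ 251 ⟩
  67 ℕ.+ (182 ℕ.+ n ℕ.* 243 ℕ.+ tail) ℕ.+ 251
    ≡⟨ regroup (n ℕ.* 243) tail ⟩
  500 ℕ.+ n ℕ.* 243 ℕ.+ tail ∎
  where
  open ℕₚ.≤-Reasoning
  tail = suc l ℕ.* (500 ℕ.+ n ℕ.* 243)
  regroup : ∀ x y → 67 ℕ.+ (182 ℕ.+ x ℕ.+ y) ℕ.+ 251 ≡ 500 ℕ.+ x ℕ.+ y
  regroup = solve-∀

-- Evaluation of the program and its cost

module Execution (𝕣 : Reals) {m : ℕ} (δ : Fin m → Fin m → Reals.ℝ 𝕣) where
  open Reals 𝕣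
  open Merging 𝕣
  open Semantics 𝕣 greedyProgram δ
  open Selection 𝕣 δ

  vertices : List (Fin m) → Tree
  vertices = encodeList encodeFin

  route : Route (Fin m) → Tree
  route p = vertices (forward p) ∙ vertices (backward p)

  routeList : List (Route (Fin m)) → Tree
  routeList = encodeList route

  planTree : Plan (Fin m) → Tree
  planTree c = routeList (routes c)

  infix 4 _[_]⇓_#_ _[_]⇓_within_

  _[_]⇓_#_ : ∀ f → Vec Tree (greedyArity f) → Tree → ℕ → Set
  f [ us ]⇓ v # t = us ⊢ greedyBody f ⇓ v # t

  _[_]⇓_within_ : ∀ f → Vec Tree (greedyArity f) → Tree → ℕ → Set
  f [ us ]⇓ v within b = ∃[ t ] f [ us ]⇓ v # t × t ℕ.≤ b

  append⇓ : ∀ (xs ys : List (Fin m)) →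
            #append [ vertices xs ∷ vertices ys ∷ [] ]⇓ vertices (xs ++ ys) # appendTime (length xs)
  append⇓ []       ys = case-nil (var _) (var _)
  append⇓ (x ∷ xs) ys = case-cons (var _) (cons (var _) (call (var _ ∷ var _ ∷ []) (append⇓ xs ys)))

  join⇓ : ∀ p q → #join [ route p ∷ route q ∷ [] ]⇓ route (join p q)
                  # 5 ℕ.+ (3 ℕ.+ appendTime (length (forward p)) ℕ.+ (3 ℕ.+ appendTime (length (backward q))))
  join⇓ p q = case-cons (var _) (case-cons (var _)
    (cons (call (var _ ∷ var _ ∷ []) (append⇓ (forward p) (forward q)))
          (call (var _ ∷ var _ ∷ []) (append⇓ (backward q) (backward p)))))

  gap⇓ : ∀ c → #gap [ planTree c ∷ [] ]⇓ encodeList encodeEdge [ final (one c) , first (two c) ] # 17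
  gap⇓ c = case-cons (var _) (case-cons (var _) (case-cons (var _) (case-cons (var _) (case-cons (var _)
    (case-cons (var _) (cons (cons (var _) (var _)) nil))))))

  shorter⇓ : ∀ c d → #shorter [ planTree c ∷ planTree d ∷ [] ]⇓ planTree (shorter c d) within 43
  shorter⇓ c d with (gap c + 0#) <? (gap d + 0#)
  ... | yes c<d =
    _ , case-cons (less-yes _ _ (call (var _ ∷ []) (gap⇓ c)) (call (var _ ∷ []) (gap⇓ d)) c<d) (var _) , ℕₚ.≤-refl
  ... | no  c≮d =
    _ , case-nil (less-no _ _ (call (var _ ∷ []) (gap⇓ c)) (call (var _ ∷ []) (gap⇓ d)) c≮d) (var _) , ℕₚ.≤-refl

  opposite⇓ : ∀ p → #opposite [ route p ∷ [] ]⇓ route (opposite p) # 5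
  opposite⇓ p = case-cons (var _) (cons (var _) (var _))

  orient⇓ : ∀ p q r → #orient [ route p ∷ route q ∷ routeList r ∷ [] ]⇓ planTree (orient p q r) within 176
  orient⇓ p q r =
    let _ , D , s≤ = shorter⇓ (plan p q r) (plan p (opposite q) r)
        _ , E , t≤ = shorter⇓ (plan (opposite p) q r) (plan (opposite p) (opposite q) r)
        _ , F , u≤ = shorter⇓ (shorter (plan p q r) (plan p (opposite q) r))
                              (shorter (plan (opposite p) q r) (plan (opposite p) (opposite q) r))
    in _
     , call ( call (cons (var _) (cons (var _) (var _)) ∷ cons (var _) (cons q̅ (var _)) ∷ []) D
            ∷ call (cons p̅ (cons (var _) (var _)) ∷ cons p̅ (cons q̅ (var _)) ∷ []) E
            ∷ []) F
     , s≤s (ℕₚ.+-mono-≤ (ℕₚ.+-mono-≤ (ℕₚ.+-monoʳ-≤ 17 s≤) (ℕₚ.+-monoˡ-≤ 0 (ℕₚ.+-monoʳ-≤ 29 t≤))) u≤)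
    where
    ρ = route p ∷ route q ∷ routeList r ∷ []
    p̅ : ρ ⊢ call #opposite (var 0F ∷ []) ⇓ route (opposite p) # 7
    p̅ = call (var _ ∷ []) (opposite⇓ p)
    q̅ : ρ ⊢ call #opposite (var 1F ∷ []) ⇓ route (opposite q) # 7
    q̅ = call (var _ ∷ []) (opposite⇓ q)

  keep⇓ : ∀ p c → #keep [ route p ∷ planTree c ∷ [] ]⇓ planTree (keep p c) within 11
  keep⇓ p c =
    _ , case-cons (var _) (case-cons (var _) (cons (var _) (cons (var _) (cons (var _) (var _))))) , ℕₚ.≤-refl

  -- The recursive clauses of `#bestWith` and `#best` have the same shape: a direct search `s`, a
  -- recursive call `t`, one `#keep` and one `#shorter`. The constant is 67 = 13 + 11 + 43.
  searchTime : ∀ {s t u v a b} → s ℕ.≤ a → t ℕ.≤ b → u ℕ.≤ 11 → v ℕ.≤ 43 →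
    3 ℕ.+ (4 ℕ.+ s ℕ.+ (suc (suc (4 ℕ.+ t ℕ.+ 0) ℕ.+ u) ℕ.+ 0) ℕ.+ v) ℕ.≤ 67 ℕ.+ (a ℕ.+ b)
  searchTime {s} {t} {u} {v} {a} {b} s≤a t≤b u≤ v≤ = begin
    3 ℕ.+ (4 ℕ.+ s ℕ.+ (suc (suc (4 ℕ.+ t ℕ.+ 0) ℕ.+ u) ℕ.+ 0) ℕ.+ v) ≡⟨ regroup s t u v ⟩
    13 ℕ.+ (u ℕ.+ v) ℕ.+ (s ℕ.+ t)  ≤⟨ ℕₚ.+-mono-≤ (ℕₚ.+-monoʳ-≤ 13 (ℕₚ.+-mono-≤ u≤ v≤)) (ℕₚ.+-mono-≤ s≤a t≤b) ⟩
    67 ℕ.+ (a ℕ.+ b) ∎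
    where
    open ℕₚ.≤-Reasoning
    regroup : ∀ s t u v → 3 ℕ.+ (4 ℕ.+ s ℕ.+ (suc (suc (4 ℕ.+ t ℕ.+ 0) ℕ.+ u) ℕ.+ 0) ℕ.+ v) ≡ 13 ℕ.+ (u ℕ.+ v) ℕ.+ (s ℕ.+ t)
    regroup = solve-∀

  bestWith⇓ : ∀ p q rs → #bestWith [ route p ∷ route q ∷ routeList rs ∷ [] ]⇓ planTree (bestWith p q rs)
              within bestWithTime (length rs)
  bestWith⇓ p q [] =
    let _ , D , t≤ = orient⇓ p q []
    in _ , case-nil (var _) (call (var _ ∷ var _ ∷ var _ ∷ []) D) , ℕₚ.+-monoʳ-≤ 6 t≤
  bestWith⇓ p q (q′ ∷ qs) =
    let _ , D , s≤ = orient⇓ p q (q′ ∷ qs)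
        _ , E , t≤ = bestWith⇓ p q′ qs
        _ , F , u≤ = keep⇓ q (bestWith p q′ qs)
        _ , G , v≤ = shorter⇓ (orient p q (q′ ∷ qs)) (keep q (bestWith p q′ qs))
    in _ , case-cons (var _) (call ( call (var _ ∷ var _ ∷ var _ ∷ []) D
                                   ∷ call (var _ ∷ call (var _ ∷ var _ ∷ var _ ∷ []) E ∷ []) F ∷ []) G)
     , ℕₚ.≤-trans (searchTime s≤ t≤ u≤ v≤) (ℕₚ.≤-reflexive (regroup (length qs ℕ.* 243)))
    where
    regroup : ∀ x → 67 ℕ.+ (176 ℕ.+ (182 ℕ.+ x)) ≡ 182 ℕ.+ (243 ℕ.+ x)
    regroup = solve-∀

  best⇓ : ∀ p q rs → #best [ route p ∷ route q ∷ routeList rs ∷ [] ]⇓ planTree (best p q rs)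
          within bestTime (length rs)
  best⇓ p q [] =
    let _ , D , t≤ = bestWith⇓ p q []
    in _ , case-nil (var _) (call (var _ ∷ var _ ∷ var _ ∷ []) D) , ℕₚ.+-monoʳ-≤ 6 t≤
  best⇓ p q (r ∷ rs) =
    let _ , D , s≤ = bestWith⇓ p q (r ∷ rs)
        _ , E , t≤ = best⇓ q r rs
        _ , F , u≤ = keep⇓ p (best q r rs)
        _ , G , v≤ = shorter⇓ (bestWith p q (r ∷ rs)) (keep p (best q r rs))
    in _ , case-cons (var _) (call ( call (var _ ∷ var _ ∷ var _ ∷ []) D
                                   ∷ call (var _ ∷ call (var _ ∷ var _ ∷ var _ ∷ []) E ∷ []) F ∷ []) G)
     , searchTime s≤ t≤ u≤ v≤

  -- The bound `n` on the total number of vertices stays fixed during the recursion, since joining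
  -- preserves the vertices; it bounds the cost of every round. The counter `k` drops by one with
  -- each join.
  solve⇓ : ∀ n k p rs → length rs ≡ k → k ℕ.≤ n → length (concat (forwards (p ∷ rs))) ℕ.≤ n →
           ∃[ R ] ∃[ t ] Merges δ (forwards (p ∷ rs)) R ×
           #solve [ route p ∷ routeList rs ∷ [] ]⇓ vertices R # t × t ℕ.≤ suc k ℕ.* roundTime n
  solve⇓ n zero p [] refl _ _ =
    forward p , 5 , single , case-nil (var _) (case-cons (var _) (var _)) , ℕₚ.m≤m+n 5 _
  solve⇓ n (suc k) p (q ∷ rs) refl k<n size≤n =
    let R , t , M , D , t≤ = solve⇓ n k (join (one c) (two c)) (rest c) fewer (ℕₚ.<⇒≤ k<n)
                               (ℕₚ.≤-trans (ℕₚ.≤-reflexive (↭-length sameVertices)) size≤n)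
    in R , _ , merge-best p q rs M
     , case-cons (var _) (case-cons (call (var _ ∷ var _ ∷ var _ ∷ []) (proj₁ (proj₂ (best⇓ p q rs)))) (case-cons (var _)
         (call (call (var _ ∷ var _ ∷ []) (join⇓ (one c) (two c)) ∷ var _ ∷ []) D)))
     , bound t≤
    where
    c = best p q rs
    a = length (forward (one c))
    b = length (backward (two c))
    search = proj₁ (best⇓ p q rs)
    search≤ = proj₂ (proj₂ (best⇓ p q rs))
    open ℕₚ.≤-Reasoning

    fewer : length (rest c) ≡ k
    fewer = ℕₚ.suc-injective (ℕₚ.suc-injective (trans (cong (λ l → suc (suc l)) (sym (length-map forward (rest c))))
      (trans (sym (≈-length (best-≈ p q rs))) (cong (λ l → suc (suc l)) (length-map forward rs)))))

    sameVertices : concat (forwards (join (one c) (two c) ∷ rest c)) ↭ concat (forwards (p ∷ q ∷ rs))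
    sameVertices = ↭-trans (↭-reflexive (++-assoc (forward (one c)) _ _)) (↭-sym (≈-concat (best-≈ p q rs)))

    a+b≤n : a ℕ.+ b ℕ.≤ n
    a+b≤n = begin
      a ℕ.+ b
        ≡⟨ cong (λ xs → a ℕ.+ length xs) (sym (mirror (two c))) ⟩
      a ℕ.+ length (reverse (forward (two c)))
        ≡⟨ cong (a ℕ.+_) (length-reverse (forward (two c))) ⟩
      a ℕ.+ length (forward (two c))
        ≡⟨ length-++ (forward (one c)) ⟨
      length (forward (join (one c) (two c)))
        ≤⟨ ℕₚ.m≤m+n _ _ ⟩
      length (forward (join (one c) (two c))) ℕ.+ length (concat (forwards (rest c)))
        ≡⟨ length-++ (forward (join (one c) (two c))) ⟨
      length (concat (forwards (join (one c) (two c) ∷ rest c)))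
        ≡⟨ ↭-length sameVertices ⟩
      length (concat (forwards (p ∷ q ∷ rs)))
        ≤⟨ size≤n ⟩
      n ∎

    regroup : ∀ x a b t →
      3 ℕ.+ (4 ℕ.+ x ℕ.+ (2 ℕ.+ (1 ℕ.+ (3 ℕ.+ (5 ℕ.+ (3 ℕ.+ (3 ℕ.+ a ℕ.* 7) ℕ.+ (3 ℕ.+ (3 ℕ.+ b ℕ.* 7)))) ℕ.+ 1 ℕ.+ t))))
        ℕ.+ 19
      ≡ 50 ℕ.+ (x ℕ.+ (a ℕ.+ b) ℕ.* 7) ℕ.+ t
    regroup = solve-∀

    bound : ∀ {t} → t ℕ.≤ suc k ℕ.* roundTime n →
      3 ℕ.+ (4 ℕ.+ search ℕ.+ (2 ℕ.+ (1 ℕ.+ (3 ℕ.+ (5 ℕ.+ (3 ℕ.+ appendTime a ℕ.+ (3 ℕ.+ appendTime b))) ℕ.+ 1 ℕ.+ t))))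
      ℕ.≤ suc (suc k) ℕ.* roundTime n
    bound {t} t≤ = begin
      -- The fixed overhead of a round is 31; adding 19 rounds it up to the 50 in `roundTime`.
      _ ≤⟨ ℕₚ.m≤m+n _ 19 ⟩
      _ ≡⟨ regroup search a b t ⟩
      50 ℕ.+ (search ℕ.+ (a ℕ.+ b) ℕ.* 7) ℕ.+ t
        ≤⟨ ℕₚ.+-mono-≤ (ℕₚ.+-monoʳ-≤ 50 (ℕₚ.+-mono-≤
             (ℕₚ.≤-trans search≤ (ℕₚ.≤-trans (bestTime-bound (ℕₚ.<⇒≤ k<n))
               (ℕₚ.*-monoˡ-≤ (500 ℕ.+ n ℕ.* 243) (ℕₚ.≤-trans k<n (ℕₚ.n≤1+n n)))))
             (ℕₚ.*-monoˡ-≤ 7 a+b≤n))) t≤ ⟩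
      roundTime n ℕ.+ suc k ℕ.* roundTime n ∎

  singletons⇓ : ∀ k (k≤m : k ℕ.≤ m) →
                #singletons [ encodeℕ k ∷ [] ]⇓ routeList (map trivial (downFrom k k≤m)) # singletonsTime k
  singletons⇓ zero    _   = case-nil (var _) nil
  singletons⇓ (suc k) k<m rewrite Finₚ.toℕ-fromℕ< k<m =
    case-cons (var _) (cons (cons (cons (var _) nil) (cons (var _) nil)) (call (var _ ∷ []) (singletons⇓ k (ℕₚ.<⇒≤ k<m))))

  -- Stated for an arbitrary list of length `m`, so that the two branches of `main` can be separated
  -- by matching on the list while `m` stays a variable.
  route-all : ∀ vs {s} → length vs ≡ m → s ℕ.≤ singletonsTime m →
              #singletons [ encodeℕ m ∷ [] ]⇓ routeList (map trivial vs) # s →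
              ∃[ R ] ∃[ t ] Merges δ (map [_] vs) R × Outputs (R ∷ []) t × t ℕ.≤ 8 ℕ.+ singletonsTime m ℕ.+ solveTime m
  route-all [] {s} _ s≤ D = [] , _ , none , case-nil (call (var _ ∷ []) D) (cons nil nil) , (begin
    3 ℕ.+ s ℕ.+ 3                          ≤⟨ ℕₚ.+-monoˡ-≤ 3 (ℕₚ.+-monoʳ-≤ 3 s≤) ⟩
    3 ℕ.+ singletonsTime m ℕ.+ 3           ≡⟨ regroup (singletonsTime m) ⟩
    6 ℕ.+ singletonsTime m                 ≤⟨ ℕₚ.m≤n+m _ 2 ⟩
    8 ℕ.+ singletonsTime m                 ≤⟨ ℕₚ.m≤m+n _ _ ⟩
    8 ℕ.+ singletonsTime m ℕ.+ solveTime m ∎)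
    where
    open ℕₚ.≤-Reasoning
    regroup : ∀ x → 3 ℕ.+ x ℕ.+ 3 ≡ 6 ℕ.+ x
    regroup = solve-∀
  route-all (v ∷ vs) {s} len s≤ D =
    let R , t , M , E , t≤ = solve⇓ m (length vs) (trivial v) (map trivial vs) (length-map trivial vs) |vs|≤m
                               (ℕₚ.≤-reflexive (trans (cong length (trans (cong concat singles) (concat-map-[_] (v ∷ vs)))) len))
    in R , _ , subst (λ ps → Merges δ ps R) singles M
     , case-cons (call (var _ ∷ []) D) (cons (call (var _ ∷ var _ ∷ []) E) nil)
     , bound t≤
    where
    open ℕₚ.≤-Reasoning
    |vs|≤m : length vs ℕ.≤ m
    |vs|≤m = ℕₚ.≤-trans (ℕₚ.n≤1+n _) (ℕₚ.≤-reflexive len)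
    singles : forwards (map trivial (v ∷ vs)) ≡ map [_] (v ∷ vs)
    singles = sym (map-∘ (v ∷ vs))
    regroup : ∀ s t → suc (suc (suc s) ℕ.+ suc (suc (2 ℕ.+ t) ℕ.+ 1)) ≡ 8 ℕ.+ s ℕ.+ t
    regroup = solve-∀
    bound : ∀ {t} → t ℕ.≤ suc (length vs) ℕ.* roundTime m →
            suc (suc (suc s) ℕ.+ suc (suc (2 ℕ.+ t) ℕ.+ 1)) ℕ.≤ 8 ℕ.+ singletonsTime m ℕ.+ solveTime m
    bound {t} t≤ = begin
      _             ≡⟨ regroup s t ⟩
      8 ℕ.+ s ℕ.+ t ≤⟨ ℕₚ.+-mono-≤ (ℕₚ.+-monoʳ-≤ 8 s≤) (ℕₚ.≤-trans t≤ (ℕₚ.*-monoˡ-≤ (roundTime m) (s≤s |vs|≤m))) ⟩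
      8 ℕ.+ singletonsTime m ℕ.+ solveTime m ∎

  greedyProgram-outputs : ∃[ R ] ∃[ t ] Merges δ (map [_] (downFrom m ℕₚ.≤-refl)) R × Outputs (R ∷ []) t ×
                          t ℕ.≤ 8 ℕ.+ singletonsTime m ℕ.+ solveTime m
  greedyProgram-outputs =
    route-all (downFrom m ℕₚ.≤-refl) (length-downFrom m ℕₚ.≤-refl) ℕₚ.≤-refl (singletons⇓ m ℕₚ.≤-refl)

n≤n*n : ∀ n → n ℕ.≤ n ℕ.* n
n≤n*n zero    = z≤n
n≤n*n (suc n) = ℕₚ.m≤m*n (suc n) (suc n)

-- Expand with symbolic coefficients and replace `n` and its square by the cube, which dominates
-- them for every natural number, 0 included.
cubic-bound : ∀ a b c d e f g n C → a ℕ.+ b ℕ.+ d ℕ.+ e ℕ.≤ C →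
  (c ℕ.+ d ℕ.+ e ℕ.+ e ℕ.+ f ℕ.+ g) ℕ.+ (e ℕ.+ f ℕ.+ f ℕ.+ g) ℕ.+ f ℕ.≤ C →
  a ℕ.+ (b ℕ.+ n ℕ.* c) ℕ.+ suc n ℕ.* (d ℕ.+ (suc n ℕ.* (e ℕ.+ n ℕ.* f) ℕ.+ n ℕ.* g)) ℕ.≤ C ℕ.* n ℕ.^ 3 ℕ.+ C
cubic-bound a b c d e f g n C constant≤ rest≤ = begin
  a ℕ.+ (b ℕ.+ n ℕ.* c) ℕ.+ suc n ℕ.* (d ℕ.+ (suc n ℕ.* (e ℕ.+ n ℕ.* f) ℕ.+ n ℕ.* g))
    ≡⟨ expand a b c d e f g n ⟩
  p ℕ.* n ℕ.+ q ℕ.* (n ℕ.* n) ℕ.+ f ℕ.* cube ℕ.+ (a ℕ.+ b ℕ.+ d ℕ.+ e)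
    ≤⟨ ℕₚ.+-mono-≤ (ℕₚ.+-monoˡ-≤ (f ℕ.* cube) (ℕₚ.+-mono-≤
         (ℕₚ.*-monoʳ-≤ p (ℕₚ.≤-trans (n≤n*n n) n*n≤cube)) (ℕₚ.*-monoʳ-≤ q n*n≤cube))) constant≤ ⟩
  p ℕ.* cube ℕ.+ q ℕ.* cube ℕ.+ f ℕ.* cube ℕ.+ C
    ≡⟨ cong (ℕ._+ C) (trans (cong (ℕ._+ f ℕ.* cube) (sym (ℕₚ.*-distribʳ-+ cube p q)))
         (sym (ℕₚ.*-distribʳ-+ cube (p ℕ.+ q) f))) ⟩
  (p ℕ.+ q ℕ.+ f) ℕ.* cube ℕ.+ C
    ≤⟨ ℕₚ.+-monoˡ-≤ C (ℕₚ.*-monoˡ-≤ cube rest≤) ⟩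
  C ℕ.* cube ℕ.+ C
    ≡⟨ cong (λ m → C ℕ.* (n ℕ.* (n ℕ.* m)) ℕ.+ C) (sym (ℕₚ.*-identityʳ n)) ⟩
  C ℕ.* n ℕ.^ 3 ℕ.+ C ∎
  where
  open ℕₚ.≤-Reasoning
  p = c ℕ.+ d ℕ.+ e ℕ.+ e ℕ.+ f ℕ.+ g
  q = e ℕ.+ f ℕ.+ f ℕ.+ g
  cube = n ℕ.* (n ℕ.* n)
  n*n≤cube : n ℕ.* n ℕ.≤ cube
  n*n≤cube = ℕₚ.*-monoʳ-≤ n (n≤n*n n)
  expand : ∀ a b c d e f g n →
    a ℕ.+ (b ℕ.+ n ℕ.* c) ℕ.+ (1 ℕ.+ n) ℕ.* (d ℕ.+ ((1 ℕ.+ n) ℕ.* (e ℕ.+ n ℕ.* f) ℕ.+ n ℕ.* g)) ≡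
    (c ℕ.+ d ℕ.+ e ℕ.+ e ℕ.+ f ℕ.+ g) ℕ.* n ℕ.+ (e ℕ.+ f ℕ.+ f ℕ.+ g) ℕ.* (n ℕ.* n)
      ℕ.+ f ℕ.* (n ℕ.* (n ℕ.* n)) ℕ.+ (a ℕ.+ b ℕ.+ d ℕ.+ e)
  expand = solve-∀

totalTime-bound : ∀ n → 8 ℕ.+ singletonsTime n ℕ.+ solveTime n ℕ.≤ 4000 ℕ.* n ℕ.^ 3 ℕ.+ 4000
-- The constant term is 561 and the remaining coefficients add up to 2548; 4000 is a round number
-- above both.
totalTime-bound n = cubic-bound 8 3 12 50 500 243 7 n 4000 (ℕₚ.≤ᵇ⇒≤ 561 4000 _) (ℕₚ.≤ᵇ⇒≤ 2548 4000 _)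

-- Distances

module Geometry (𝕣 : Reals) (d : ℕ) where
  open Reals 𝕣
  open CommutativeRing commutativeRing
    using (+-comm; +-assoc; +-identityˡ; +-identityʳ; -‿inverseˡ; -‿inverseʳ
          ; *-identityˡ; *-identityʳ; zeroˡ; zeroʳ; distribˡ; distribʳ; ring; commutativeSemiring)
  open RingProperties ring using (+-cancelʳ)
  open SemiringSolver commutativeSemiring using (solve; _:=_; _:+_; _:*_)
  open SquareRoot 𝕣
  open Euclidean 𝕣 d

  +-mono-≤ : ∀ {x y u v} → x ≤ y → u ≤ v → x + u ≤ y + v
  +-mono-≤ {x} {y} {u} {v} x≤y u≤v =
    ≤-trans (subst₂ _≤_ (+-comm u x) (+-comm u y) (+-monoʳ-≤ u x≤y)) (+-monoʳ-≤ y u≤v)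

  square-mono-≤ : ∀ {x y} → 0# ≤ x → x ≤ y → x * x ≤ y * y
  square-mono-≤ 0≤x (inj₁ x<y)  = inj₁ (square-mono-< 0≤x x<y)
  square-mono-≤ 0≤x (inj₂ refl) = inj₂ refl

  square-injective : ∀ {x y} → 0# ≤ x → 0# ≤ y → x * x ≡ y * y → x ≡ y
  square-injective {x} {y} 0≤x 0≤y x²≡y² with compare x y
  ... | tri< x<y _ _ = contradiction (square-mono-< 0≤x x<y) (<-irrefl x²≡y²)
  ... | tri≈ _ x≡y _ = x≡y
  ... | tri> _ _ y<x = contradiction (square-mono-< 0≤y y<x) (<-irrefl (sym x²≡y²))

  x-y+y-z≡x-z : ∀ x y z → (x - y) + (y - z) ≡ x - z
  x-y+y-z≡x-z x y z = trans (+-assoc x (- y) (y - z)) (cong (x +_)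
    (trans (sym (+-assoc (- y) y (- z))) (trans (cong (_+ - z) (-‿inverseˡ y)) (+-identityˡ (- z)))))

  -- With `a + b ≡ 0#`, both squares become zero after adding `a * b`.
  [x-y]²≡[y-x]² : ∀ x y → (x - y) * (x - y) ≡ (y - x) * (y - x)
  [x-y]²≡[y-x]² x y = +-cancelʳ (a * b) (a * a) (b * b)
    (trans (sym (distribˡ a a b)) (trans (cong (a *_) a+b≡0) (trans (zeroʳ a)
    (sym (trans (sym (distribʳ b b a)) (trans (cong (_* b) (trans (+-comm b a) a+b≡0)) (zeroˡ b)))))))
    where
    a = x - y
    b = y - x
    a+b≡0 : a + b ≡ 0#
    a+b≡0 = trans (x-y+y-z≡x-z x y x) (-‿inverseʳ x)

  -- Since 2(e + t)² + 2t² = e² + (e + 2t)².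
  square-triangle : ∀ x y z → (x - y) * (x - y) ≤
                    ((x - z) * (x - z) + (y - z) * (y - z)) + ((x - z) * (x - z) + (y - z) * (y - z))
  square-triangle x y z = subst (λ u → (x - y) * (x - y) ≤ (u * u + t * t) + (u * u + t * t)) (x-y+y-z≡x-z x y z)
    (subst (e * e ≤_)
      (solve 2 (λ e t → e :* e :+ (e :+ (t :+ t)) :* (e :+ (t :+ t))
                     := ((e :+ t) :* (e :+ t) :+ t :* t) :+ ((e :+ t) :* (e :+ t) :+ t :* t)) refl e t)
      (x≤x+y (e * e) (square-nonNeg (e + (t + t)))))
    where
    e = x - y
    t = y - z

  sumOfSquares-triangle : ∀ {k} (x y z : Vec ℝ k) → let s = λ u v → sumOfSquares (Vec.zipWith _-_ u v) in
                          s x y ≤ (s x z + s y z) + (s x z + s y z)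
  sumOfSquares-triangle [] [] [] =
    inj₂ (sym (trans (cong₂ _+_ (+-identityˡ 0#) (+-identityˡ 0#)) (+-identityˡ 0#)))
  sumOfSquares-triangle (x ∷ xs) (y ∷ ys) (z ∷ zs) =
    subst ((x - y) * (x - y) + sumOfSquares (Vec.zipWith _-_ xs ys) ≤_)
      (solve 4 (λ a b c d → ((a :+ b) :+ (a :+ b)) :+ ((c :+ d) :+ (c :+ d)) :=
                            ((a :+ c) :+ (b :+ d)) :+ ((a :+ c) :+ (b :+ d))) refl _ _ _ _)
      (+-mono-≤ (square-triangle x y z) (sumOfSquares-triangle xs ys zs))

  sumOfSquares-sym : ∀ {k} (x y : Vec ℝ k) → sumOfSquares (Vec.zipWith _-_ x y) ≡ sumOfSquares (Vec.zipWith _-_ y x)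
  sumOfSquares-sym []       []       = refl
  sumOfSquares-sym (x ∷ xs) (y ∷ ys) = cong₂ _+_ ([x-y]²≡[y-x]² x y) (sumOfSquares-sym xs ys)

  dist² : Point → Point → ℝ
  dist² x y = dist x y * dist x y

  dist-nonNeg : ∀ x y → 0# ≤ dist x y
  dist-nonNeg x y = proj₁ (proj₂ (sqrt _ (sumOfSquares-nonNeg (Vec.zipWith _-_ x y))))

  dist²≡sum : ∀ x y → dist² x y ≡ sumOfSquares (Vec.zipWith _-_ x y)
  dist²≡sum x y = proj₂ (proj₂ (sqrt _ (sumOfSquares-nonNeg (Vec.zipWith _-_ x y))))

  dist-sym : ∀ x y → dist x y ≡ dist y x
  dist-sym x y = square-injective (dist-nonNeg x y) (dist-nonNeg y x)
    (trans (dist²≡sum x y) (trans (sumOfSquares-sym x y) (sym (dist²≡sum y x))))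

  dist²-triangle : ∀ x y z → dist² x y ≤ (dist² x z + dist² y z) + (dist² x z + dist² y z)
  dist²-triangle x y z = subst₂ _≤_ (sym (dist²≡sum x y))
    (cong (λ u → u + u) (cong₂ _+_ (sym (dist²≡sum x z)) (sym (dist²≡sum y z)))) (sumOfSquares-triangle x y z)

  2# 4# : ℝ
  2# = 1# + 1#
  4# = 2# + 2#

  0≤1 : 0# ≤ 1#
  0≤1 = inj₁ 0<1

  0≤4 : 0# ≤ 4#
  0≤4 = +-nonNeg (+-nonNeg 0≤1 0≤1) (+-nonNeg 0≤1 0≤1)

  ball-dist² : ∀ p x → Ball p 1# x → dist² x p ≤ 1#
  ball-dist² p x x∈B = subst (dist² x p ≤_) (*-identityˡ 1#) (square-mono-≤ (dist-nonNeg x p) x∈B)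

  -- Compare both distances with 2.
  separated : ∀ {p x y a b} → Ball p 1# x → ¬ Ball p 4# y → Ball p 1# a → Ball p 1# b → ¬ dist x y ≤ dist a b
  separated {p} {x} {y} {a} {b} x∈B y∉B a∈B b∈B xy≤ab = <⇒≱ 16<yp² (≤-trans yp²≤10 10≤16)
    where
    4<yp : 4# < dist y p
    4<yp with compare 4# (dist y p)
    ... | tri< 4<yp _ _ = 4<yp
    ... | tri≈ _ eq _   = contradiction (inj₂ (sym eq)) y∉B
    ... | tri> _ _ yp<4 = contradiction (inj₁ yp<4) y∉B

    16<yp² : 4# * 4# < dist² y p
    16<yp² = square-mono-< 0≤4 4<yp

    ab²≤4 : dist² a b ≤ 4#
    ab²≤4 = ≤-trans (dist²-triangle a b p) (+-mono-≤ ≤2 ≤2)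
      where ≤2 = +-mono-≤ (ball-dist² p a a∈B) (ball-dist² p b b∈B)

    yx²≤4 : dist² y x ≤ 4#
    yx²≤4 = ≤-trans (subst (λ u → u * u ≤ dist² a b) (dist-sym x y) (square-mono-≤ (dist-nonNeg x y) xy≤ab)) ab²≤4

    px²≤1 : dist² p x ≤ 1#
    px²≤1 = subst (λ u → u * u ≤ 1#) (dist-sym x p) (ball-dist² p x x∈B)

    yp²≤10 : dist² y p ≤ (4# + 1#) + (4# + 1#)
    yp²≤10 = ≤-trans (dist²-triangle y p x) (+-mono-≤ ≤5 ≤5)
      where ≤5 = +-mono-≤ yx²≤4 px²≤1

    10≤16 : (4# + 1#) + (4# + 1#) ≤ 4# * 4#
    10≤16 = subst ((4# + 1#) + (4# + 1#) ≤_)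
      (trans (solve 1 (λ u → ((u :+ u :+ (u :+ u) :+ u) :+ (u :+ u :+ (u :+ u) :+ u)) :+ (u :+ u :+ (u :+ u) :+ (u :+ u))
                          := ((u :+ u :+ (u :+ u)) :+ (u :+ u :+ (u :+ u))) :+ ((u :+ u :+ (u :+ u)) :+ (u :+ u :+ (u :+ u)))) refl 1#)
        (sym (trans (distribʳ 4# 2# 2#) (cong₂ _+_ 2*4 2*4))))
      (x≤x+y _ (+-nonNeg 0≤4 (+-nonNeg 0≤1 0≤1)))
      where
      2*4 : 2# * 4# ≡ 4# + 4#
      2*4 = trans (distribʳ 4# 1# 1#) (cong₂ _+_ (*-identityˡ 4#) (*-identityˡ 4#))

  -- Consequences of general position

  module _ {m : ℕ} (Y : Fin m → Point) where

    edgeDist : Edge m → ℝ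
    edgeDist (i , j) = dist (Y i) (Y j)

    private
      _≟_ = ≡-dec (Fin._≟_ {m}) (Fin._≟_ {m})

      weighted : (Edge m → ℝ) → Edges m → ℝ
      weighted ξ = foldr (λ e s → ξ e * edgeDist e + s) 0#

      indicator : Edge m → Edge m → ℝ
      indicator a e with e ≟ a
      ... | yes _ = 1#
      ... | no  _ = 0#

      indicator-self : ∀ a → indicator a a ≡ 1#
      indicator-self a with a ≟ a
      ... | yes _  = refl
      ... | no a≢a = contradiction refl a≢a

      indicator-other : ∀ {a e} → e ≢ a → indicator a e ≡ 0#
      indicator-other {a} {e} e≢a with e ≟ a
      ... | yes e≡a = contradiction e≡a e≢a
      ... | no  _   = refl

      weighted-outside : ∀ {a es} → a ∉ es → weighted (indicator a) es ≡ 0#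
      weighted-outside {a} {[]} a∉ = refl
      weighted-outside {a} {e ∷ es} a∉ = trans
        (cong₂ _+_ (trans (cong (_* edgeDist e) (indicator-other (λ e≡a → a∉ (here (sym e≡a))))) (zeroˡ _))
                   (weighted-outside (λ a∈ → a∉ (there a∈))))
        (+-identityˡ 0#)

      weighted-inside : ∀ {a es} → Unique es → a ∈ es → weighted (indicator a) es ≡ edgeDist a
      weighted-inside {a} {a ∷ es} (a≢ ∷ _) (here refl) = trans
        (cong₂ _+_ (trans (cong (_* edgeDist a) (indicator-self a)) (*-identityˡ _))
                   (weighted-outside (λ a∈ → All.lookup a≢ a∈ refl)))
        (+-identityʳ _)
      weighted-inside {a} {e ∷ es} (e≢ ∷ u) (there a∈) = trans
        (cong₂ _+_ (trans (cong (_* edgeDist e) (indicator-other (All.lookup e≢ a∈))) (zeroˡ _)) (weighted-inside u a∈))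
        (+-identityˡ _)

      -- Put additively, so that the semiring solver, which has no subtraction, can regroup the
      -- terms.
      weighted-minus : ∀ ξ η es → weighted (λ e → ξ e - η e) es + weighted η es ≡ weighted ξ es
      weighted-minus ξ η []       = +-identityˡ 0#
      weighted-minus ξ η (e ∷ es) = trans
        (solve 4 (λ a b c d → (a :+ b) :+ (c :+ d) := (a :+ c) :+ (b :+ d)) refl _ _ _ _)
        (cong₂ _+_ (trans (sym (distribʳ _ _ _)) (cong (_* edgeDist e) cancel)) (weighted-minus ξ η es))
        where
        cancel : (ξ e - η e) + η e ≡ ξ e
        cancel = trans (+-assoc _ _ _) (trans (cong (ξ e +_) (-‿inverseˡ _)) (+-identityʳ _))

      pairs-unique : Unique (pairs m)
      pairs-unique = Uniqueₚ.filter⁺ _ (Uniqueₚ.cartesianProduct⁺ (Uniqueₚ.allFin⁺ m) (Uniqueₚ.allFin⁺ m))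

      ∈-pairs : ∀ {i j} → i Fin.< j → (i , j) ∈ pairs m
      ∈-pairs {i} {j} i<j =
        ∈-filter⁺ (λ e → proj₁ e Finₚ.<? proj₂ e) (∈-cartesianProduct⁺ (∈-allFin i) (∈-allFin j)) i<j

    -- If `a` and `b` differed, the coefficients 1 at `a`, -1 at `b` and 0 elsewhere would give a
    -- vanishing combination, namely the difference of the two distances.
    generic-injective : GeneralPosition Y → ∀ {a b} → a ∈ pairs m → b ∈ pairs m → edgeDist a ≡ edgeDist b → a ≡ b
    generic-injective gp {a} {b} a∈ b∈ a≡b with a ≟ b
    ... | yes eq = eq
    ... | no a≢b = contradiction
      (+-cancelʳ (edgeDist b) _ _ (trans (trans (cong (weighted ξ (pairs m) +_) (sym (weighted-inside pairs-unique b∈)))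
        (weighted-minus (indicator a) (indicator b) (pairs m)))
        (trans (weighted-inside pairs-unique a∈) (trans a≡b (sym (+-identityˡ _))))))
      (gp ξ ξ-values (a , a∈ , λ ξa≡0 → <-irrefl (trans (sym ξa≡0) ξa≡1) 0<1))
      where
      ξ : Edge m → ℝ
      ξ e = indicator a e - indicator b e

      x-0≡x : ∀ x → x - 0# ≡ x
      x-0≡x x = trans (sym (+-identityʳ _)) (trans (+-assoc x (- 0#) 0#) (trans (cong (x +_) (-‿inverseˡ 0#)) (+-identityʳ x)))

      ξa≡1 : ξ a ≡ 1#
      ξa≡1 = trans (cong₂ _-_ (indicator-self a) (indicator-other a≢b)) (x-0≡x 1#)

      ξ-values : ∀ e → ξ e ≡ 0# ⊎ ξ e ≡ 1# ⊎ ξ e ≡ - 1#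
      ξ-values e with e ≟ a | e ≟ b
      ... | yes refl | yes refl = contradiction refl a≢b
      ... | yes _    | no _     = inj₂ (inj₁ (x-0≡x 1#))
      ... | no _     | yes _    = inj₂ (inj₂ (+-identityˡ _))
      ... | no _     | no _     = inj₁ (x-0≡x 0#)

    -- `pairs` holds one orientation of each edge, so both edges are first sorted; this is where the
    -- alternative in the conclusion comes from.
    generic-distances : GeneralPosition Y → ∀ {i j k l} → i ≢ j → k ≢ l → dist (Y i) (Y j) ≡ dist (Y k) (Y l) →
                        (i ≡ k × j ≡ l) ⊎ (i ≡ l × j ≡ k)
    generic-distances gp {i} {j} {k} {l} i≢j k≢l eq with Finₚ.<-cmp i j | Finₚ.<-cmp k l
    ... | tri≈ _ i≡j _ | _ = contradiction i≡j i≢j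
    ... | _ | tri≈ _ k≡l _ = contradiction k≡l k≢l
    ... | tri< i<j _ _ | tri< k<l _ _ with refl ← generic-injective gp (∈-pairs i<j) (∈-pairs k<l) eq = inj₁ (refl , refl)
    ... | tri< i<j _ _ | tri> _ _ l<k
      with refl ← generic-injective gp (∈-pairs i<j) (∈-pairs l<k) (trans eq (dist-sym (Y k) (Y l))) = inj₂ (refl , refl)
    ... | tri> _ _ j<i | tri< k<l _ _
      with refl ← generic-injective gp (∈-pairs j<i) (∈-pairs k<l) (trans (dist-sym (Y j) (Y i)) eq) = inj₂ (refl , refl)
    ... | tri> _ _ j<i | tri> _ _ l<k
      with refl ← generic-injective gp (∈-pairs j<i) (∈-pairs l<k) (trans (dist-sym (Y j) (Y i)) (trans eq (dist-sym (Y k) (Y l)))) =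
      inj₁ (refl , refl)

-- Graphs

≈-sym : ∀ {A : Set} {ps qs : List (List A)} → ps ≈ qs → qs ≈ ps
≈-sym ≈-refl         = ≈-refl
≈-sym (≈-trans r s)  = ≈-trans (≈-sym s) (≈-sym r)
≈-sym (prep P r)     = prep P (≈-sym r)
≈-sym (swap P Q)     = swap Q P
≈-sym (flip P {ps})  = ≈-trans (flip (reverse P)) (≈-reflexive (cong (_∷ ps) (reverse-involutive P)))

Any-≈ : ∀ {A : Set} {C : List A → Set} → (∀ {P} → C P → C (reverse P)) →
        ∀ {ps qs} → ps ≈ qs → Any C ps → Any C qs
Any-≈ C-rev ≈-refl        i                 = i
Any-≈ C-rev (≈-trans r s) i                 = Any-≈ C-rev s (Any-≈ C-rev r i)
Any-≈ C-rev (prep P r)    (here c)          = here c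
Any-≈ C-rev (prep P r)    (there i)         = there (Any-≈ C-rev r i)
Any-≈ C-rev (swap P Q)    (here c)          = there (here c)
Any-≈ C-rev (swap P Q)    (there (here c))  = here c
Any-≈ C-rev (swap P Q)    (there (there i)) = there (there i)
Any-≈ C-rev (flip P)      (here c)          = here (C-rev c)
Any-≈ C-rev (flip P)      (there i)         = there i

Unique-resp-↭ : ∀ {A : Set} {xs ys : List A} → xs ↭ ys → Unique xs → Unique ys
Unique-resp-↭ Perm.refl          u                  = u
Unique-resp-↭ (Perm.prep x r)    (x≢ ∷ u)           = All-resp-↭ r x≢ ∷ Unique-resp-↭ r u
Unique-resp-↭ (Perm.swap x y r)  ((x≢y ∷ x≢) ∷ y≢ ∷ u) =
  ((λ y≡x → x≢y (sym y≡x)) ∷ All-resp-↭ r y≢) ∷ All-resp-↭ r x≢ ∷ Unique-resp-↭ r u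
Unique-resp-↭ (Perm.trans r s)   u                  = Unique-resp-↭ s (Unique-resp-↭ r u)

module _ {A : Set} where

  Unique-head : ∀ {x : A} {xs} → Unique (x ∷ xs) → x ∉ xs
  Unique-head (x≢ ∷ _) x∈ = All.lookup x≢ x∈ refl

  Unique-++ˡ : ∀ xs {ys : List A} → Unique (xs ++ ys) → Unique xs
  Unique-++ˡ []       u        = []
  Unique-++ˡ (x ∷ xs) (x≢ ∷ u) = Allₚ.++⁻ˡ xs x≢ ∷ Unique-++ˡ xs u

  Unique-++ʳ : ∀ xs {ys : List A} → Unique (xs ++ ys) → Unique ys
  Unique-++ʳ []       u       = u
  Unique-++ʳ (x ∷ xs) (_ ∷ u) = Unique-++ʳ xs u

  Unique-disjoint : ∀ xs {ys : List A} {x} → Unique (xs ++ ys) → x ∈ xs → x ∉ ys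
  Unique-disjoint (x ∷ xs) u       (here refl) x∈ys = Unique-head u (∈-++⁺ʳ xs x∈ys)
  Unique-disjoint (x ∷ xs) (_ ∷ u) (there x∈)  x∈ys = Unique-disjoint xs u x∈ x∈ys

  Together : List (List A) → A → A → Set
  Together ps x y = Any (λ P → x ∈ P × y ∈ P) ps

  Together-≈ : ∀ {ps qs x y} → ps ≈ qs → Together ps x y → Together qs x y
  Together-≈ = Any-≈ (λ (x∈ , y∈) → reverse⁺ x∈ , reverse⁺ y∈)

  Starts-∈ : ∀ {x : A} {P} → Starts x P → x ∈ P
  Starts-∈ (_ , refl) = here refl

  Starts-unique : ∀ {x y : A} {P} → Starts x P → Starts y P → x ≡ y
  Starts-unique (_ , refl) (_ , refl) = refl

  Starts-reverse-∈ : ∀ {x : A} P → Starts x (reverse P) → x ∈ P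
  Starts-reverse-∈ P s = reverse⁻ (Starts-∈ s)

  snoc-view : ∀ {x : A} P → Starts x (reverse P) → ∃[ xs ] P ≡ xs ∷ʳ x
  snoc-view {x} P (xs , eq) = reverse xs , trans (sym (reverse-involutive P)) (trans (cong reverse eq) (unfold-reverse x xs))

  module _ {ps : List (List A)} {P Q : List A} {rest : List (List A)} {x y : A} (r : ps ≈ P ∷ Q ∷ rest)
           (sx : Starts x (reverse P)) (sy : Starts y Q) (u : Unique (concat ps)) where

    private
      u′ : Unique (P ++ Q ++ concat rest)
      u′ = Unique-resp-↭ (≈-concat r) u

      x∈P = Starts-reverse-∈ P sx
      y∈Q = Starts-∈ sy

    -- The ends lie on different paths because `concat ps` has no repetition. This is used twice:
    -- the joining edge is new, and no single path of the family is Hamiltonian.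
    ends-apart : ¬ Together ps x y
    ends-apart t with Together-≈ r t
    ... | here (_ , y∈P)         = Unique-disjoint P u′ y∈P (∈-++⁺ˡ y∈Q)
    ... | there (here (x∈Q , _)) = Unique-disjoint P u′ x∈P (∈-++⁺ˡ x∈Q)
    ... | there (there i)        = Unique-disjoint P u′ x∈P (∈-++⁺ʳ Q (∈-concat⁺ (Any.map proj₁ i)))

    ends-distinct : x ≢ y
    ends-distinct refl = Unique-disjoint P u′ x∈P (∈-++⁺ˡ y∈Q)

    left-end-∈ : x ∈ concat ps
    left-end-∈ = ∈-resp-↭ (↭-sym (≈-concat r)) (∈-++⁺ˡ x∈P)

    right-end-∈ : y ∈ concat ps
    right-end-∈ = ∈-resp-↭ (↭-sym (≈-concat r)) (∈-++⁺ʳ P (∈-++⁺ˡ y∈Q))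

  -- An interior vertex is exhibited with both of its neighbours, which will show that its degree is
  -- already 2.
  end-or-interior : ∀ {x : A} {P} → x ∈ P → IsEnd x P ⊎ (∃[ xs ] ∃[ a ] ∃[ b ] ∃[ ys ] P ≡ xs ++ a ∷ x ∷ b ∷ ys)
  end-or-interior {P = x ∷ P} (here refl) = inj₁ (inj₁ (P , refl))
  end-or-interior {x} {z ∷ P} (there x∈) with end-or-interior x∈
  ... | inj₁ (inj₁ ([] , refl))        = inj₁ (inj₂ (z ∷ [] , refl))
  ... | inj₁ (inj₁ (b ∷ ys , refl))    = inj₂ ([] , z , b , ys , refl)
  ... | inj₁ (inj₂ (ys , eq))          = inj₁ (inj₂ (ys ∷ʳ z , trans (unfold-reverse z P) (cong (_∷ʳ z) eq)))
  ... | inj₂ (xs , a , b , ys , refl)  = inj₂ (z ∷ xs , a , b , ys , refl)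

  same-or-candidate : ∀ {ps} {x y : A} → Any (IsEnd x) ps → Any (IsEnd y) ps →
                      (∃[ P ] P ∈ ps × IsEnd x P × IsEnd y P) ⊎ (Candidate ps x y ⊎ Candidate ps y x)
  same-or-candidate (here ex)  (here ey)  = inj₁ (_ , here refl , ex , ey)
  same-or-candidate (here ex)  (there j)  = inj₂ (inj₁ (here ex j))
  same-or-candidate (there i)  (here ey)  = inj₂ (inj₂ (here ey i))
  same-or-candidate (there i)  (there j)  with same-or-candidate i j
  ... | inj₁ (P , P∈ , ends)  = inj₁ (P , there P∈ , ends)
  ... | inj₂ c                = inj₂ (Sum.map there there c)

-- Edges of paths and cycles

SameEdge : ∀ {n} → Edge n → Edge n → Set
SameEdge (u , v) (x , y) = (u ≡ x × v ≡ y) ⊎ (u ≡ y × v ≡ x)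

module _ {n : ℕ} where

  -- The cut vertex is kept on both sides, so that no edge is lost.
  pathEdges-split : ∀ xs (u : Fin n) ys → pathEdges (xs ++ u ∷ ys) ≡ pathEdges (xs ∷ʳ u) ++ pathEdges (u ∷ ys)
  pathEdges-split []           u ys = refl
  pathEdges-split (x ∷ [])     u ys = refl
  pathEdges-split (x ∷ y ∷ xs) u ys = cong ((x , y) ∷_) (pathEdges-split (y ∷ xs) u ys)

  pathEdges-∈ : ∀ {x y : Fin n} P → (x , y) ∈ pathEdges P → x ∈ P × y ∈ P
  pathEdges-∈ (x ∷ y ∷ P) (here refl) = here refl , there (here refl)
  pathEdges-∈ (z ∷ y ∷ P) (there e) with x∈ , y∈ ← pathEdges-∈ (y ∷ P) e = there x∈ , there y∈

  pathEdges-reverse : ∀ {x y : Fin n} P → (x , y) ∈ pathEdges P → (y , x) ∈ pathEdges (reverse P)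
  pathEdges-reverse (x ∷ y ∷ P) e = subst (_ ∈_) (sym edges) (split e)
    where
    edges : pathEdges (reverse (x ∷ y ∷ P)) ≡ pathEdges (reverse (y ∷ P)) ++ [ y , x ]
    edges = trans (cong pathEdges (trans (unfold-reverse x (y ∷ P))
      (trans (cong (_∷ʳ x) (unfold-reverse y P)) (++-assoc (reverse P) [ y ] [ x ]))))
      (trans (pathEdges-split (reverse P) y [ x ]) (cong (λ R → pathEdges R ++ [ y , x ]) (sym (unfold-reverse y P))))
    split : ∀ {a b} → (a , b) ∈ (x , y) ∷ pathEdges (y ∷ P) → (b , a) ∈ pathEdges (reverse (y ∷ P)) ++ [ y , x ]
    split (here refl) = ∈-++⁺ʳ (pathEdges (reverse (y ∷ P))) (here refl)
    split (there e)   = ∈-++⁺ˡ (pathEdges-reverse (y ∷ P) e)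

  Joined : List (List (Fin n)) → Fin n → Fin n → Set
  Joined ps x y = Any (λ P → Adjacent (pathEdges P) x y) ps

  Adjacent-∈ : ∀ {x y : Fin n} {P} → Adjacent (pathEdges P) x y → x ∈ P × y ∈ P
  Adjacent-∈ {P = P} (inj₁ e) = pathEdges-∈ P e
  Adjacent-∈ {P = P} (inj₂ e) with y∈ , x∈ ← pathEdges-∈ P e = x∈ , y∈

  Adjacent-reverse : ∀ {x y : Fin n} {P} → Adjacent (pathEdges P) x y → Adjacent (pathEdges (reverse P)) x y
  Adjacent-reverse {P = P} (inj₁ e) = inj₂ (pathEdges-reverse P e)
  Adjacent-reverse {P = P} (inj₂ e) = inj₁ (pathEdges-reverse P e)

  Adjacent-∷ : ∀ {e : Edge n} {E x y} → Adjacent E x y → Adjacent (e ∷ E) x y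
  Adjacent-∷ = Sum.map there there

  Adjacent-uncons : ∀ {e : Edge n} {E x y} → Adjacent (e ∷ E) x y → SameEdge e (x , y) ⊎ Adjacent E x y
  Adjacent-uncons (inj₁ (here refl)) = inj₁ (inj₁ (refl , refl))
  Adjacent-uncons (inj₁ (there i))   = inj₂ (inj₁ i)
  Adjacent-uncons (inj₂ (here refl)) = inj₁ (inj₂ (refl , refl))
  Adjacent-uncons (inj₂ (there i))   = inj₂ (inj₂ i)

  Adjacent-head : ∀ {e : Edge n} {E x y} → SameEdge e (x , y) → Adjacent (e ∷ E) x y
  Adjacent-head (inj₁ (refl , refl)) = inj₁ (here refl)
  Adjacent-head (inj₂ (refl , refl)) = inj₂ (here refl)

  Adjacent-++⁻ : ∀ (E : Edges n) {F x y} → Adjacent (E ++ F) x y → Adjacent E x y ⊎ Adjacent F x y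
  Adjacent-++⁻ E (inj₁ i) = Sum.map inj₁ inj₁ (∈-++⁻ E i)
  Adjacent-++⁻ E (inj₂ i) = Sum.map inj₂ inj₂ (∈-++⁻ E i)

  Adjacent-++⁺ : ∀ (E : Edges n) {F x y} → Adjacent E x y ⊎ Adjacent F x y → Adjacent (E ++ F) x y
  Adjacent-++⁺ E (inj₁ i) = Sum.map ∈-++⁺ˡ ∈-++⁺ˡ i
  Adjacent-++⁺ E (inj₂ i) = Sum.map (∈-++⁺ʳ E) (∈-++⁺ʳ E) i

  Joined-≈ : ∀ {ps qs x y} → ps ≈ qs → Joined ps x y → Joined qs x y
  Joined-≈ = Any-≈ (λ {P} → Adjacent-reverse {P = P})

  Joined⇒Together : ∀ {ps x y} → Joined ps x y → Together ps x y
  Joined⇒Together = Any.map (λ {P} → Adjacent-∈ {P = P})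

  pathEdges-join : ∀ P {Q} {u v : Fin n} → Starts u (reverse P) → Starts v Q →
                   pathEdges (P ++ Q) ≡ pathEdges P ++ (u , v) ∷ pathEdges Q
  pathEdges-join P {u = u} {v} su (Q , refl) with xs , refl ← snoc-view P su =
    trans (cong pathEdges (++-assoc xs [ u ] (v ∷ Q))) (pathEdges-split xs u (v ∷ Q))

  module _ {P Q : List (Fin n)} {rest : List (List (Fin n))} {u v : Fin n} (su : Starts u (reverse P)) (sv : Starts v Q) where

    Joined-join⁻ : ∀ {x y} → Joined ((P ++ Q) ∷ rest) x y → SameEdge (u , v) (x , y) ⊎ Joined (P ∷ Q ∷ rest) x y
    Joined-join⁻ (there i) = inj₂ (there (there i))
    Joined-join⁻ {x} {y} (here a)
      with Adjacent-++⁻ (pathEdges P) (subst (λ E → Adjacent E x y) (pathEdges-join P su sv) a)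
    ... | inj₁ a′ = inj₂ (here a′)
    ... | inj₂ a′ = Sum.map₂ (λ a″ → there (here a″)) (Adjacent-uncons a′)

    Joined-join⁺ : ∀ {x y} → SameEdge (u , v) (x , y) ⊎ Joined (P ∷ Q ∷ rest) x y → Joined ((P ++ Q) ∷ rest) x y
    Joined-join⁺ {x} {y} c = go c
      where
      back : Adjacent (pathEdges P) x y ⊎ Adjacent ((u , v) ∷ pathEdges Q) x y → Joined ((P ++ Q) ∷ rest) x y
      back a = here (subst (λ E → Adjacent E x y) (sym (pathEdges-join P su sv)) (Adjacent-++⁺ (pathEdges P) a))
      go : SameEdge (u , v) (x , y) ⊎ Joined (P ∷ Q ∷ rest) x y → Joined ((P ++ Q) ∷ rest) x y
      go (inj₁ s)                 = back (inj₂ (Adjacent-head s))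
      go (inj₂ (here a))          = back (inj₁ a)
      go (inj₂ (there (here a)))  = back (inj₂ (Adjacent-∷ a))
      go (inj₂ (there (there i))) = there i

  start-neighbour : ∀ {P} {x a b : Fin n} → Starts x P → Unique P →
                    Adjacent (pathEdges P) x a → Adjacent (pathEdges P) x b → a ≡ b
  start-neighbour {x = x} (P , refl) u i j = trans (second P u i) (sym (second P u j))
    where
    next : List (Fin n) → Fin n
    -- A one-vertex path has no neighbour to return; `x` is an arbitrary default.
    next []      = x
    next (y ∷ _) = y
    second : ∀ P → Unique (x ∷ P) → ∀ {a} → Adjacent (pathEdges (x ∷ P)) x a → a ≡ next P
    second []      u (inj₁ ())
    second []      u (inj₂ ())
    second (y ∷ P) u i with Adjacent-uncons i
    ... | inj₁ (inj₁ (_ , y≡a)) = sym y≡a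
    ... | inj₁ (inj₂ (_ , y≡x)) = contradiction (here (sym y≡x)) (Unique-head u)
    ... | inj₂ j                = contradiction (proj₁ (Adjacent-∈ {P = y ∷ P} j)) (Unique-head u)

  -- `G` stands for adjacency and `C` for the vertex set of a cycle; having this at every vertex of
  -- `C` is the property of cycles that the peeling argument uses.
  TwoNeighbours : (Fin n → Fin n → Set) → (Fin n → Set) → Fin n → Set
  TwoNeighbours G C x = ∃[ a ] ∃[ b ] a ≢ b × C a × C b × G x a × G x b

  last-edge : ∀ (x a y : Fin n) zs → ∃[ b ] b ∈ y ∷ zs × (b , x) ∈ pathEdges (a ∷ y ∷ zs ++ [ x ])
  last-edge x a y []       = y , here refl , there (here refl)
  last-edge x a y (z ∷ zs) with b , b∈ , e ← last-edge x y z zs = b , there b∈ , there e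

  ends-of-cycle : ∀ (x : Fin n) ys → 2 ℕ.≤ length ys → Unique ys →
                  ∃[ a ] ∃[ b ] a ≢ b × a ∈ ys × b ∈ ys × (x , a) ∈ cycleEdges (x ∷ ys) × (b , x) ∈ cycleEdges (x ∷ ys)
  ends-of-cycle x (a ∷ []) (s≤s ()) _
  ends-of-cycle x (a ∷ y ∷ zs) _ u with b , b∈ , e ← last-edge x a y zs =
    a , b , (λ a≡b → Unique-head u (subst (_∈ y ∷ zs) (sym a≡b) b∈)) , here refl , there b∈ , here refl , there e

  cycleEdges-rotate : ∀ xs (x : Fin n) ys {e} → e ∈ cycleEdges (x ∷ ys ++ xs) → e ∈ cycleEdges (xs ++ x ∷ ys)
  cycleEdges-rotate []       x ys {e} i = subst (λ zs → e ∈ cycleEdges (x ∷ zs)) (++-identityʳ ys) i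
  cycleEdges-rotate (y ∷ xs) x ys {e} i =
    subst (e ∈_) (sym to) (∈-resp-↭ (↭-++-comm (pathEdges (x ∷ ys ∷ʳ y)) _) (subst (e ∈_) from i))
    where
    from : cycleEdges (x ∷ ys ++ y ∷ xs) ≡ pathEdges (x ∷ ys ∷ʳ y) ++ pathEdges (y ∷ xs ∷ʳ x)
    from = trans (cong (λ zs → pathEdges (x ∷ zs)) (++-assoc ys (y ∷ xs) [ x ])) (pathEdges-split (x ∷ ys) y (xs ∷ʳ x))
    to : cycleEdges (y ∷ xs ++ x ∷ ys) ≡ pathEdges (y ∷ xs ∷ʳ x) ++ pathEdges (x ∷ ys ∷ʳ y)
    to = trans (cong (λ zs → pathEdges (y ∷ zs)) (++-assoc xs (x ∷ ys) [ y ])) (pathEdges-split (y ∷ xs) x (ys ∷ʳ y))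

  -- Rotate the cycle to start at `x`: the neighbours are its second and its last vertex, distinct
  -- because there are at least three vertices.
  cycle-neighbours : ∀ {c} {x : Fin n} → IsCycle c → x ∈ c → TwoNeighbours (Adjacent (cycleEdges c)) (_∈ c) x
  cycle-neighbours (3≤ , u) x∈ with xs , ys , refl ← ∈-∃++ x∈
    with 3≤′ ← subst (3 ℕ.≤_) (↭-length (↭-++-comm xs (_ ∷ ys))) 3≤ | u′ ← Unique-resp-↭ (↭-++-comm xs (_ ∷ ys)) u
    with a , b , a≢b , a∈ , b∈ , e , f ← ends-of-cycle _ (ys ++ xs) (ℕₚ.≤-pred 3≤′) (Unique-++ʳ [ _ ] u′) =
    a , b , a≢b , back a∈ , back b∈ , inj₁ (cycleEdges-rotate xs _ ys e) , inj₂ (cycleEdges-rotate xs _ ys f)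
    where
    back : ∀ {z} → z ∈ ys ++ xs → z ∈ xs ++ _ ∷ ys
    back z∈ = ∈-resp-↭ (↭-++-comm (_ ∷ ys) xs) (there z∈)

  ⊆ᴱ-Adjacent : ∀ {E F : Edges n} → F ⊆ᴱ E → ∀ {x y} → Adjacent F x y → Adjacent E x y
  ⊆ᴱ-Adjacent F⊆E (inj₁ i) = All.lookup F⊆E i
  ⊆ᴱ-Adjacent F⊆E (inj₂ i) = Sum.swap (All.lookup F⊆E i)

  cycleEdges-∈ : ∀ {x y : Fin n} c → (x , y) ∈ cycleEdges c → x ∈ c × y ∈ c
  cycleEdges-∈ (z ∷ c) e with x∈ , y∈ ← pathEdges-∈ (z ∷ c ++ [ z ]) e = back x∈ , back y∈
    where
    back : ∀ {w} → w ∈ z ∷ c ++ [ z ] → w ∈ z ∷ c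
    back (here refl) = here refl
    back (there w∈) with ∈-++⁻ c w∈
    ... | inj₁ w∈c         = there w∈c
    ... | inj₂ (here refl) = here refl

-- Graphs that consist of disjoint paths on a vertex set

module _ {n : ℕ} where

  -- A cycle misses a path whose vertices have no further neighbours on
  -- the cycle: peel off the vertices of the path from its start.
  cycle-misses-path : ∀ {G : Fin n → Fin n → Set} {C : Fin n → Set} → (∀ {z} → C z → TwoNeighbours G C z) →
    ∀ P → Unique P → (∀ {z w} → z ∈ P → C z → C w → G z w → Adjacent (pathEdges P) z w) → ∀ {z} → z ∈ P → ¬ C z
  cycle-misses-path {G} {C} neighbours (x ∷ P) u local = λ { (here refl) → x∉C ; (there z∈) → later P u local z∈ }
    where
    x∉C : ¬ C x
    x∉C x∈C with a , b , a≢b , a∈C , b∈C , xa , xb ← neighbours x∈C =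
      a≢b (start-neighbour (P , refl) u (local (here refl) x∈C a∈C xa) (local (here refl) x∈C b∈C xb))

    later : ∀ P → Unique (x ∷ P) →
            (∀ {z w} → z ∈ x ∷ P → C z → C w → G z w → Adjacent (pathEdges (x ∷ P)) z w) →
            ∀ {z} → z ∈ P → ¬ C z
    later (y ∷ P) u@(_ ∷ u′) local = cycle-misses-path neighbours (y ∷ P) u′ local′
      where
      -- The edge back to the removed start `x` need not be accounted for, since `x` is already
      -- known to be off the cycle. Hence locality asks for `C w` as well.
      local′ : ∀ {z w} → z ∈ y ∷ P → C z → C w → G z w → Adjacent (pathEdges (y ∷ P)) z w
      local′ z∈ z∈C w∈C zw with Adjacent-uncons (local (there z∈) z∈C w∈C zw)
      ... | inj₁ (inj₁ (refl , _)) = contradiction z∈ (Unique-head u)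
      ... | inj₁ (inj₂ (refl , _)) = contradiction w∈C x∉C
      ... | inj₂ a                 = a

  cycle-misses-paths : ∀ {G : Fin n → Fin n → Set} {C : Fin n → Set} → (∀ {z} → C z → TwoNeighbours G C z) →
    ∀ ps → Unique (concat ps) → (∀ {z w} → z ∈ concat ps → G z w → Joined ps z w) → ∀ {z} → z ∈ concat ps → ¬ C z
  cycle-misses-paths {G} {C} neighbours (P ∷ ps) u local z∈ with ∈-++⁻ P z∈
  ... | inj₁ z∈P  = cycle-misses-path neighbours P (Unique-++ˡ P u) inside z∈P
    where
    inside : ∀ {z w} → z ∈ P → C z → C w → G z w → Adjacent (pathEdges P) z w
    inside z∈ _ _ zw with local (∈-++⁺ˡ z∈) zw
    ... | here a  = a
    ... | there i = contradiction (∈-concat⁺ (Any.map proj₁ (Joined⇒Together i))) (Unique-disjoint P u z∈)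
  ... | inj₂ z∈ps = cycle-misses-paths neighbours ps (Unique-++ʳ P u) outside z∈ps
    where
    outside : ∀ {z w} → z ∈ concat ps → G z w → Joined ps z w
    outside z∈ zw with local (∈-++⁺ʳ P z∈) zw
    ... | here a  = contradiction z∈ (Unique-disjoint P u (proj₁ (Adjacent-∈ {P = P} a)))
    ... | there i = i

  -- The invariant of the whole argument. `complete` covers every edge of `E` with an endpoint on
  -- the paths, so it also says that no edge leaves their vertex set; edges entirely outside are
  -- unrestricted.
  record Exact (E : Edges n) (ps : List (List (Fin n))) : Set where
    field
      complete : ∀ {x y} → x ∈ concat ps → Adjacent E x y → Joined ps x y
      sound    : ∀ {x y} → Joined ps x y → Adjacent E x y

  open Exact

  Joined-∈ : ∀ {ps} {x y : Fin n} → Joined ps x y → x ∈ concat ps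
  Joined-∈ i = ∈-concat⁺ (Any.map proj₁ (Joined⇒Together i))

  Exact-≈ : ∀ {E ps qs} → ps ≈ qs → Exact E ps → Exact E qs
  Exact-≈ r ex = record
    { complete = λ x∈ a → Joined-≈ r (complete ex (∈-resp-↭ (↭-sym (≈-concat r)) x∈) a)
    ; sound    = λ i → sound ex (Joined-≈ (≈-sym r) i) }

  Exact-outside : ∀ {E ps u v} → Exact E ps → u ∉ concat ps → v ∉ concat ps → Exact ((u , v) ∷ E) ps
  Exact-outside {E} {ps} {u} {v} ex u∉ v∉ = record { complete = c ; sound = λ i → Adjacent-∷ (sound ex i) }
    where
    c : ∀ {x y} → x ∈ concat ps → Adjacent ((u , v) ∷ E) x y → Joined ps x y
    c x∈ a with Adjacent-uncons a
    ... | inj₁ (inj₁ (refl , _)) = contradiction x∈ u∉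
    ... | inj₁ (inj₂ (_ , refl)) = contradiction x∈ v∉
    ... | inj₂ a′                = complete ex x∈ a′

  SameEdge-trans : ∀ {e f g : Edge n} → SameEdge e f → SameEdge f g → SameEdge e g
  SameEdge-trans (inj₁ (refl , refl)) s                    = s
  SameEdge-trans (inj₂ (refl , refl)) (inj₁ (refl , refl)) = inj₂ (refl , refl)
  SameEdge-trans (inj₂ (refl , refl)) (inj₂ (refl , refl)) = inj₁ (refl , refl)

  SameEdge-sym : ∀ {e f : Edge n} → SameEdge e f → SameEdge f e
  SameEdge-sym (inj₁ (refl , refl)) = inj₁ (refl , refl)
  SameEdge-sym (inj₂ (refl , refl)) = inj₂ (refl , refl)

  Exact-join : ∀ {E ps P Q rest u v e} → ps ≈ P ∷ Q ∷ rest → Starts u (reverse P) → Starts v Q →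
               SameEdge e (u , v) →
               Exact E ps → Exact (e ∷ E) ((P ++ Q) ∷ rest)
  Exact-join {E} {ps} {P} {Q} {rest} {u} {v} {e} r su sv e~uv ex = record
    { complete = λ x∈ a → Joined-join⁺ su sv (c (subst (_ ∈_) (++-assoc P Q (concat rest)) x∈) (Adjacent-uncons a))
    ; sound    = λ i → s (Joined-join⁻ su sv i) }
    where
    ex′ = Exact-≈ r ex
    c : ∀ {x y} → x ∈ P ++ Q ++ concat rest → SameEdge e (x , y) ⊎ Adjacent E x y →
        SameEdge (u , v) (x , y) ⊎ Joined (P ∷ Q ∷ rest) x y
    c x∈ (inj₁ e~xy) = inj₁ (SameEdge-trans (SameEdge-sym e~uv) e~xy)
    c x∈ (inj₂ a)    = inj₂ (complete ex′ x∈ a)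
    s : ∀ {x y} → SameEdge (u , v) (x , y) ⊎ Joined (P ∷ Q ∷ rest) x y → Adjacent (e ∷ E) x y
    s (inj₁ uv~xy) = Adjacent-head (SameEdge-trans e~uv uv~xy)
    s (inj₂ i)     = Adjacent-∷ (sound ex′ i)

  -- By exactness each path is a connected component of `E`, so the peeling argument applies to the
  -- vertices of `c`.
  no-cycle-through : ∀ {E ps c} → Exact E ps → Unique (concat ps) → IsCycle c → cycleEdges c ⊆ᴱ E →
                     ∀ {x} → x ∈ concat ps → x ∉ c
  no-cycle-through {E} {ps} {c} ex u cyc c⊆E = cycle-misses-paths neighbours ps u (complete ex)
    where
    neighbours : ∀ {z} → z ∈ c → TwoNeighbours (Adjacent E) (_∈ c) z
    neighbours z∈ with a , b , a≢b , a∈ , b∈ , za , zb ← cycle-neighbours cyc z∈ =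
      a , b , a≢b , a∈ , b∈ , ⊆ᴱ-Adjacent c⊆E za , ⊆ᴱ-Adjacent c⊆E zb

  first-neighbour : ∀ {E ps P rest} {x a b : Fin n} → ps ≈ P ∷ rest → Starts x P → Exact E ps → Unique (concat ps) →
                    Adjacent E x a → Adjacent E x b → a ≡ b
  first-neighbour {P = P} {rest} {x} r s ex u xa xb =
    start-neighbour s (Unique-++ˡ P u′) (inside (complete (Exact-≈ r ex) x∈ xa)) (inside (complete (Exact-≈ r ex) x∈ xb))
    where
    u′ = Unique-resp-↭ (≈-concat r) u
    x∈ = ∈-++⁺ˡ {ys = concat rest} (Starts-∈ s)
    inside : ∀ {y} → Joined (P ∷ rest) x y → Adjacent (pathEdges P) x y
    inside (here a)  = a
    inside (there i) = contradiction (Joined-∈ i) (Unique-disjoint P u′ (Starts-∈ s))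

  Incident : Edge n → Fin n → Set
  Incident e x = proj₁ e ≡ x ⊎ proj₂ e ≡ x

  incident? : ∀ x (e : Edge n) → Dec (Incident e x)
  incident? x e = (proj₁ e Finₚ.≟ x) ⊎-dec (proj₂ e Finₚ.≟ x)

  degree-accept : ∀ e {x} E → Incident e x → degree (e ∷ E) x ≡ suc (degree E x)
  degree-accept e {x} E i = cong length (filter-accept (incident? x) {e} {E} i)

  degree-reject : ∀ e {x} E → ¬ Incident e x → degree (e ∷ E) x ≡ degree E x
  degree-reject e {x} E ¬i = cong length (filter-reject (incident? x) {e} {E} ¬i)

  degree-∷≤ : ∀ e {x} E → degree (e ∷ E) x ℕ.≤ suc (degree E x)
  degree-∷≤ e {x} E with incident? x e
  ... | yes i = ℕₚ.≤-reflexive (degree-accept e E i)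
  ... | no ¬i = ℕₚ.≤-trans (ℕₚ.≤-reflexive (degree-reject e E ¬i)) (ℕₚ.n≤1+n _)

  incident⇒SameEdge : ∀ {e x} → Incident e x → ∃[ a ] SameEdge e (x , a)
  incident⇒SameEdge {e} (inj₁ refl) = proj₂ e , inj₁ (refl , refl)
  incident⇒SameEdge {e} (inj₂ refl) = proj₁ e , inj₂ (refl , refl)

  degree≥1⇒neighbour : ∀ {x} E → 1 ℕ.≤ degree E x → ∃[ a ] Adjacent E x a
  degree≥1⇒neighbour {x} (e ∷ E) d with incident? x e
  ... | yes i with a , s ← incident⇒SameEdge i = a , Adjacent-head s
  ... | no ¬i with a , j ← degree≥1⇒neighbour E (subst (1 ℕ.≤_) (degree-reject e E ¬i) d) = a , Adjacent-∷ j

  neighbours⇒degree≥2 : ∀ {x a b} E → a ≢ b → Adjacent E x a → Adjacent E x b → 2 ℕ.≤ degree E x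
  neighbours⇒degree≥2 {x} {a} {b} E a≢b xa xb = length≥2 (edge xa) (edge xb)
    where
    edge : ∀ {y} → Adjacent E x y → ∃[ e ] SameEdge e (x , y) × e ∈ filter (incident? x) E
    edge (inj₁ i) = _ , inj₁ (refl , refl) , ∈-filter⁺ (incident? x) i (inj₁ refl)
    edge (inj₂ i) = _ , inj₂ (refl , refl) , ∈-filter⁺ (incident? x) i (inj₂ refl)
    distinct : ∀ {e} → SameEdge e (x , a) → ¬ SameEdge e (x , b)
    distinct (inj₁ (refl , refl)) (inj₁ (_ , refl))    = a≢b refl
    distinct (inj₁ (refl , refl)) (inj₂ (refl , refl)) = a≢b refl
    distinct (inj₂ (refl , refl)) (inj₁ (refl , refl)) = a≢b refl
    distinct (inj₂ (refl , refl)) (inj₂ (refl , _))    = a≢b refl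
    length≥2 : ∀ {es} → (∃[ e ] SameEdge e (x , a) × e ∈ es) → (∃[ e ] SameEdge e (x , b) × e ∈ es) → 2 ℕ.≤ length es
    length≥2 (_ , s , here refl)  (_ , t , here refl)  = contradiction t (distinct s)
    length≥2 {_ ∷ _ ∷ _} (_ , s , here refl)  (_ , t , there j) = s≤s (s≤s z≤n)
    length≥2 {_ ∷ _ ∷ _} (_ , s , there i)  _ = s≤s (s≤s z≤n)

-- Admissible edges in a state of Greedy

module GreedyStates (𝕣 : Reals) (d : ℕ) {n : ℕ} (X : Fin n → Euclidean.Point 𝕣 d) where
  open Reals 𝕣
  open Euclidean 𝕣 d hiding (Scalefree; Greedy)
  open Exact

  -- `degree` counts list entries. They give different neighbours because admissibility excludes
  -- repeated edges.
  degree≥2⇒neighbours : ∀ {E x} → GreedyState X E → 2 ℕ.≤ degree E x →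
                        ∃[ a ] ∃[ b ] a ≢ b × Adjacent E x a × Adjacent E x b
  degree≥2⇒neighbours {e ∷ E} {x} (add e g adm _) d with incident? x e
  ... | no ¬i with a , b , a≢b , xa , xb ← degree≥2⇒neighbours g (subst (2 ℕ.≤_) (degree-reject e E ¬i) d) =
    a , b , a≢b , Adjacent-∷ xa , Adjacent-∷ xb
  ... | yes i with a , s ← incident⇒SameEdge i
              | b , xb ← degree≥1⇒neighbour E (ℕₚ.≤-pred (subst (2 ℕ.≤_) (degree-accept e E i) d)) =
    a , b , (λ { refl → proj₁ (proj₂ adm) (fresh s xb) }) , Adjacent-head s , Adjacent-∷ xb
    where
    fresh : ∀ {e x a} → SameEdge e (x , a) → Adjacent E x a → Adjacent E (proj₁ e) (proj₂ e)
    fresh (inj₁ (refl , refl)) xa = xa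
    fresh (inj₂ (refl , refl)) xa = Sum.swap xa

  degree≤2 : ∀ {E} → GreedyState X E → ∀ x → degree E x ℕ.≤ 2
  degree≤2 start             x = z≤n
  degree≤2 (add {E} e g adm _) x =
    ℕₚ.≤-pred (ℕₚ.≤∧≢⇒< (ℕₚ.≤-trans (degree-∷≤ e E) (s≤s (degree≤2 g x))) (proj₁ (proj₂ (proj₂ adm)) x))

  -- The last edge added was tested against all cycles of the resulting graph, and the empty graph
  -- has none.
  cycles-Hamiltonian : ∀ {E} → GreedyState X E → ∀ c → IsCycle c → cycleEdges c ⊆ᴱ E → Hamiltonian c
  cycles-Hamiltonian start (x ∷ y ∷ c) _ (inj₁ () ∷ _)
  cycles-Hamiltonian start (x ∷ y ∷ c) _ (inj₂ () ∷ _)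
  cycles-Hamiltonian start (x ∷ []) (s≤s () , _) _
  cycles-Hamiltonian (add e g (_ , _ , _ , cycles) _) = cycles

  module _ {E : Edges n} {ps rest : List (List (Fin n))} {P Q : List (Fin n)} {u v : Fin n} (g : GreedyState X E)
           (r : ps ≈ P ∷ Q ∷ rest) (su : Starts u (reverse P)) (sv : Starts v Q) (ex : Exact E ps) (uniq : Unique (concat ps)) where

    private
      joined-concat : concat ps ↭ concat ((P ++ Q) ∷ rest)
      joined-concat = ↭-trans (≈-concat r) (↭-reflexive (sym (++-assoc P Q (concat rest))))

      few : ∀ {R rest x} → ps ≈ R ∷ rest → Starts x R → degree E x ℕ.≤ 1
      few r s = ℕₚ.≮⇒≥ λ 2≤ →
        let a , b , a≢b , xa , xb = degree≥2⇒neighbours g 2≤ in a≢b (first-neighbour r s ex uniq xa xb)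

      small : ∀ {x} → degree E x ℕ.≤ 1 → degree ((u , v) ∷ E) x ≢ 3
      small ≤1 eq = contradiction
        (ℕₚ.≤-trans (ℕₚ.≤-reflexive (sym eq)) (ℕₚ.≤-trans (degree-∷≤ (u , v) E) (s≤s ≤1)))
        λ { (s≤s (s≤s ())) }

    -- Both ends have degree at most 1, so no vertex reaches degree 3. The joined family is again
    -- exact for the enlarged graph, so a cycle there avoids `u`; hence it does not use the new edge
    -- and was already present in `E`.
    merge-admissible : Admissible E (u , v)
    merge-admissible = ends-distinct r su sv uniq
      , (λ a → ends-apart r su sv uniq (Joined⇒Together (complete ex (left-end-∈ r su sv uniq) a)))
      , degrees
      , cycles
      where
      degrees : ∀ w → degree ((u , v) ∷ E) w ≢ 3
      degrees w = by-cases (u Finₚ.≟ w) (v Finₚ.≟ w)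
        where
        by-cases : Dec (u ≡ w) → Dec (v ≡ w) → degree ((u , v) ∷ E) w ≢ 3
        by-cases (yes refl) _          = small (few (≈-trans r (flip P)) su)
        by-cases (no _)     (yes refl) = small (few (≈-trans r (swap P Q)) sv)
        by-cases (no u≢w)   (no v≢w)   eq =
          contradiction (subst (ℕ._≤ 2) (trans (sym (degree-reject (u , v) E [ u≢w , v≢w ]′)) eq) (degree≤2 g w))
            λ { (s≤s (s≤s ())) }

      cycles : ∀ c → IsCycle c → cycleEdges c ⊆ᴱ ((u , v) ∷ E) → Hamiltonian c
      cycles c cyc c⊆ = cycles-Hamiltonian g c cyc (All.tabulate λ {e} e∈ → old e e∈ (Adjacent-uncons (All.lookup c⊆ e∈)))
        where
        u∉c : u ∉ c
        u∉c = no-cycle-through (Exact-join r su sv (inj₁ (refl , refl)) ex) (Unique-resp-↭ joined-concat uniq) cyc c⊆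
                (∈-resp-↭ joined-concat (left-end-∈ r su sv uniq))
        old : ∀ e → e ∈ cycleEdges c → SameEdge (u , v) e ⊎ Adjacent E (proj₁ e) (proj₂ e) → Adjacent E (proj₁ e) (proj₂ e)
        old e e∈ (inj₂ a) = a
        old e e∈ (inj₁ (inj₁ (refl , refl))) = contradiction (proj₁ (cycleEdges-∈ c e∈)) u∉c
        old e e∈ (inj₁ (inj₂ (refl , refl))) = contradiction (proj₂ (cycleEdges-∈ c e∈)) u∉c

    -- The edge cannot join the two ends of one path R: this cycle would be
    -- Hamiltonian, but u and v do not both lie on R.
    admissible⇒candidate : ∀ {x y} → Admissible E (x , y) → x ∈ concat ps → y ∈ concat ps →
                           Candidate ps x y ⊎ Candidate ps y x
    admissible⇒candidate {x} {y} (x≢y , fresh , degrees , cycles) x∈ y∈ =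
      [ (λ (R , R∈ , ex , ey) → ⊥-elim (same-path R R∈ ex ey)) , (λ c → c) ]′
        (same-or-candidate (ends x∈ (inj₁ refl)) (ends y∈ (inj₂ refl)))
      where
      low : ∀ {z} → Incident (x , y) z → ∀ {a b} → a ≢ b → Adjacent E z a → ¬ Adjacent E z b
      low {z} i a≢b za zb = degrees z
        (trans (degree-accept (x , y) E i) (cong suc (ℕₚ.≤-antisym (degree≤2 g z) (neighbours⇒degree≥2 E a≢b za zb))))

      -- An interior vertex of a path has degree 2 already, and the new edge would raise it to 3.
      ends : ∀ {z} → z ∈ concat ps → Incident (x , y) z → Any (IsEnd z) ps
      ends {z} z∈ i = go ps uniq (sound ex) (∈-concat⁻ ps z∈)
        where
        go : ∀ ps → Unique (concat ps) → (∀ {a b} → Joined ps a b → Adjacent E a b) → Any (z ∈_) ps → Any (IsEnd z) ps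
        go (R ∷ ps) u s (there i) = there (go ps (Unique-++ʳ R u) (λ j → s (there j)) i)
        go (R ∷ ps) u s (here z∈R) with end-or-interior z∈R
        ... | inj₁ e = here e
        ... | inj₂ (xs , a , b , ys , refl) = contradiction (s (here (inj₁ (edge (there (here refl))))))
            (low i a≢b (s (here (inj₂ (edge (here refl))))))
          where
          edge : ∀ {e} → e ∈ (a , z) ∷ (z , b) ∷ pathEdges (b ∷ ys) → e ∈ pathEdges (xs ++ a ∷ z ∷ b ∷ ys)
          edge e∈ = subst (_ ∈_) (sym (pathEdges-split xs a (z ∷ b ∷ ys))) (∈-++⁺ʳ (pathEdges (xs ∷ʳ a)) e∈)
          a≢b : a ≢ b
          a≢b refl = Unique-head (Unique-++ʳ xs (Unique-++ˡ (xs ++ a ∷ z ∷ b ∷ ys) u)) (there (here refl))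

      closes : ∀ R → R ∈ ps → ∀ {a b} → Starts a R → Starts b (reverse R) → a ≢ b → ¬ Adjacent E a b →
               Adjacent ((x , y) ∷ E) b a → ⊥
      closes [] R∈ (_ , ()) _ _ _ _
      closes R@(a ∷ R′) R∈ (_ , refl) sb a≢b fresh ba with xs , eq ← snoc-view R sb =
        ends-apart r su sv uniq (Any.map (λ { refl → ∈-R u , ∈-R v }) R∈)
        where
        uniqR : ∀ ps → Unique (concat ps) → R ∈ ps → Unique R
        uniqR (_ ∷ ps) u (here refl) = Unique-++ˡ R u
        uniqR (S ∷ ps) u (there i)   = uniqR ps (Unique-++ʳ S u) i

        R⊆E : ∀ {e} → e ∈ pathEdges R → Adjacent E (proj₁ e) (proj₂ e)
        R⊆E e∈ = sound ex (Any.map (λ { refl → inj₁ e∈ }) R∈)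

        -- Distinct ends rule out one vertex and their non-adjacency rules out two, so closing the
        -- path yields a genuine cycle.
        long : ∀ R′ {b} → Starts b (reverse (a ∷ R′)) → a ≢ b → ¬ Adjacent E a b →
               (∀ {e} → e ∈ pathEdges (a ∷ R′) → Adjacent E (proj₁ e) (proj₂ e)) → 3 ℕ.≤ length (a ∷ R′)
        long []          (_ , refl) a≢b _     _   = contradiction refl a≢b
        long (_ ∷ [])    (_ , refl) _   fresh R⊆E = contradiction (R⊆E (here refl)) fresh
        long (_ ∷ _ ∷ _) _          _   _     _   = s≤s (s≤s (s≤s z≤n))

        closing : cycleEdges R ≡ pathEdges R ++ [ _ , a ]
        closing = trans (cong (λ S → pathEdges (S ∷ʳ a)) eq) (trans (cong pathEdges (++-assoc xs [ _ ] [ a ]))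
                    (trans (pathEdges-split xs _ [ a ]) (cong (λ S → pathEdges S ++ [ _ , a ]) (sym eq))))

        cycle⊆ : cycleEdges R ⊆ᴱ ((x , y) ∷ E)
        cycle⊆ = subst (_⊆ᴱ ((x , y) ∷ E)) (sym closing) (Allₚ.++⁺ (All.tabulate (λ e∈ → Adjacent-∷ (R⊆E e∈))) (ba ∷ []))

        ∈-R : ∀ z → z ∈ R
        ∈-R z = ∈-resp-↭ (↭-sym (cycles R (long R′ sb a≢b fresh R⊆E , uniqR ps uniq R∈) cycle⊆)) (∈-allFin z)

      same-path : ∀ R → R ∈ ps → IsEnd x R → IsEnd y R → ⊥
      same-path R R∈ (inj₁ sx) (inj₁ sy) = x≢y (Starts-unique sx sy)
      same-path R R∈ (inj₂ sx) (inj₂ sy) = x≢y (Starts-unique sx sy)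
      same-path R R∈ (inj₁ sx) (inj₂ sy) = closes R R∈ sx sy x≢y fresh (Adjacent-head (inj₂ (refl , refl)))
      same-path R R∈ (inj₂ sx) (inj₁ sy) =
        closes R R∈ sy sx (λ y≡x → x≢y (sym y≡x)) (λ a → fresh (Sum.swap a)) (Adjacent-head (inj₁ (refl , refl)))

-- Greedy and the joining of paths run in step

unique-↭ : ∀ {A : Set} {xs ys : List A} → Unique xs → Unique ys →
           (∀ {z} → z ∈ xs → z ∈ ys) → (∀ {z} → z ∈ ys → z ∈ xs) → xs ↭ ys
unique-↭ u v to from = ∼bag⇒↭ (unique∧set⇒bag u v (mk⇔ to from))

map-lookup-allFin : ∀ {A : Set} (xs : List A) → map (lookup xs) (allFin (length xs)) ≡ xs
map-lookup-allFin xs = trans (map-tabulate (λ i → i) (lookup xs)) (tabulate-lookup xs)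

∈-downFrom : ∀ {m} k (k≤m : k ℕ.≤ m) {i : Fin m} → Fin.toℕ i ℕ.< k → i ∈ downFrom k k≤m
∈-downFrom (suc k) k<m {i} i<1+k with ℕₚ.m≤n⇒m<n∨m≡n (ℕₚ.≤-pred i<1+k)
... | inj₁ i<k  = there (∈-downFrom k _ i<k)
... | inj₂ refl = here (sym (Finₚ.fromℕ<-toℕ i k<m))

downFrom-< : ∀ {m} k (k≤m : k ℕ.≤ m) {i} → i ∈ downFrom k k≤m → Fin.toℕ i ℕ.< k
downFrom-< (suc k) k<m (here refl) = s≤s (ℕₚ.≤-reflexive (Finₚ.toℕ-fromℕ< k<m))
downFrom-< (suc k) k<m (there i∈)  = ℕₚ.m≤n⇒m≤1+n (downFrom-< k _ i∈)

downFrom-unique : ∀ {m} k (k≤m : k ℕ.≤ m) → Unique (downFrom k k≤m)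
downFrom-unique zero    _   = []
downFrom-unique (suc k) k<m =
  All.tabulate (λ i∈ eq → ℕₚ.<-irrefl (trans (cong Fin.toℕ (sym eq)) (Finₚ.toℕ-fromℕ< k<m)) (downFrom-< k _ i∈))
  ∷ downFrom-unique k _

downFrom-↭ : ∀ m → downFrom m ℕₚ.≤-refl ↭ allFin m
downFrom-↭ m =
  unique-↭ (downFrom-unique m _) (Uniqueₚ.allFin⁺ m) (λ _ → ∈-allFin _) (λ {i} _ → ∈-downFrom m _ (Finₚ.toℕ<n i))

module LockStep (𝕣 : Reals) (d : ℕ) {n : ℕ} (W : Fin n → Fin n → Reals.ℝ 𝕣) (S : List (Fin n)) where
  open Reals 𝕣
  open Euclidean 𝕣 d using (SamePath)
  open Merging 𝕣
  open Exact

  -- Two runs of the algorithm, with results R and R′, are followed at once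
  -- because a congruent copy of S may list its points in another order.
  data Simulation (R R′ : List (Fin n)) (E : Edges n) : Set where
    running  : ∀ {ps qs} → Merges W ps R → Merges W qs R′ → length ps ≡ length qs →
               concat ps ↭ S → concat qs ↭ S → Exact E ps → Exact E qs → Simulation R R′ E
    finished : pathEdges R ⊆ᴱ E → SamePath R R′ → Simulation R R′ E

  -- A `Simulation` after looking at the next step: either S is joined up and later edges are
  -- irrelevant, or both runs still have a join to make.
  data Stage (R R′ : List (Fin n)) (E : Edges n) : Set where
    done    : pathEdges R ⊆ᴱ E → SamePath R R′ → Stage R R′ E
    pending : ∀ {ps P Q rest u v qs P′ Q′ rest′ u′ v′} →
              ps ≈ P ∷ Q ∷ rest → Starts u (reverse P) → Starts v Q →
              (∀ {x y} → Candidate ps x y → W u v ≤ W x y) →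
              Merges W ((P ++ Q) ∷ rest) R →
              qs ≈ P′ ∷ Q′ ∷ rest′ → Starts u′ (reverse P′) → Starts v′ Q′ →
              (∀ {x y} → Candidate qs x y → W u′ v′ ≤ W x y) →
              Merges W ((P′ ++ Q′) ∷ rest′) R′ →
              length ps ≡ length qs → concat ps ↭ S → concat qs ↭ S → Exact E ps → Exact E qs → Stage R R′ E

  ↭-join : ∀ {ps P Q rest} → ps ≈ P ∷ Q ∷ rest → concat ps ↭ S → concat ((P ++ Q) ∷ rest) ↭ S
  ↭-join {P = P} {Q} {rest} r ps↭S =
    ↭-trans (↭-reflexive (++-assoc P Q (concat rest))) (↭-trans (↭-sym (≈-concat r)) ps↭S)

  single-transfer : ∀ {E P Q} → concat (P ∷ []) ↭ S → concat (Q ∷ []) ↭ S → Exact E (P ∷ []) → Exact E (Q ∷ []) →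
                    ∀ {x y} → Adjacent (pathEdges P) x y → Adjacent (pathEdges Q) x y
  single-transfer {P = P} P↭S Q↭S exP exQ a =
    only (complete exQ (∈-resp-↭ (↭-trans P↭S (↭-sym Q↭S)) (Joined-∈ {ps = P ∷ []} (here a))) (sound exP (here a)))
    where
    only : ∀ {Q x y} → Joined (Q ∷ []) x y → Adjacent (pathEdges Q) x y
    only (here a) = a

  ≉-short : ∀ {ps : List (List (Fin n))} {P Q rest k} → ps ≈ P ∷ Q ∷ rest → length ps ≡ k → k ℕ.≤ 1 → ⊥
  ≉-short r len ≤1 = ℕₚ.<⇒≱ (s≤s (s≤s z≤n)) (subst (ℕ._≤ 1) (trans (sym len) (≈-length r)) ≤1)

  -- Equal numbers of paths force the two runs to stop together. When one path is left in each, both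
  -- are exact for the same `E` on the same vertices, so they have the same edges.
  stage : ∀ {R R′ E} → Simulation R R′ E → Stage R R′ E
  stage (finished R⊆E same)           = done R⊆E same
  stage (running none none _ _ _ _ _) = done [] (λ x y → mk⇔ (λ a → a) (λ a → a))
  stage (running single single _ ps↭ qs↭ ex ex′) =
    done (All.tabulate (λ e∈ → sound ex (here (inj₁ e∈))))
         (λ x y → mk⇔ (single-transfer ps↭ qs↭ ex ex′) (single-transfer qs↭ ps↭ ex′ ex))
  stage (running (merge r su sv sh M) (merge r′ su′ sv′ sh′ M′) len ps↭ qs↭ ex ex′) =
    pending r su sv sh M r′ su′ sv′ sh′ M′ len ps↭ qs↭ ex ex′
  stage (running none single () _ _ _ _)
  stage (running single none () _ _ _ _)
  stage (running none   (merge r _ _ _ _) len _ _ _ _) = ⊥-elim (≉-short r (sym len) z≤n)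
  stage (running single (merge r _ _ _ _) len _ _ _ _) = ⊥-elim (≉-short r (sym len) (s≤s z≤n))
  stage (running (merge r _ _ _ _) none   len _ _ _ _) = ⊥-elim (≉-short r len z≤n)
  stage (running (merge r _ _ _ _) single len _ _ _ _) = ⊥-elim (≉-short r len (s≤s z≤n))

  Exact-singletons : ∀ (vs : List (Fin n)) → Exact [] (map [_] vs)
  Exact-singletons vs = record
    { complete = λ { _ (inj₁ ()) ; _ (inj₂ ()) }
    ; sound    = λ i → ⊥-elim (unjoined vs i) }
    where
    unjoined : ∀ (vs : List (Fin n)) {x y} → ¬ Joined (map [_] vs) x y
    unjoined (v ∷ vs) (here (inj₁ ()))
    unjoined (v ∷ vs) (here (inj₂ ()))
    unjoined (v ∷ vs) (there i) = unjoined vs i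

  initial : ∀ {vs ws R R′} → vs ↭ S → ws ↭ S →
            Merges W (map [_] vs) R → Merges W (map [_] ws) R′ → Simulation R R′ []
  initial {vs} {ws} vs↭ ws↭ M M′ = running M M′
    (trans (length-map [_] vs) (trans (↭-length (↭-trans vs↭ (↭-sym ws↭))) (sym (length-map [_] ws))))
    (↭-trans (↭-reflexive (concat-map-[_] vs)) vs↭) (↭-trans (↭-reflexive (concat-map-[_] ws)) ws↭)
    (Exact-singletons vs) (Exact-singletons ws)

-- Greedy on a cluster, and the theorem

module Scalefreeness (𝕣 : Reals) (d : ℕ) where
  open Reals 𝕣
  open Euclidean 𝕣 d hiding (Scalefree; Greedy)
  open Geometry 𝕣 d
  open Merging 𝕣
  open Exact

  heuristic : PathFindingHeuristic
  heuristic = record { program = greedyProgram ; c = 4000 ; k = 3 ; correct = correct }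
    where
    correct : ∀ {m} (Y : Fin m → Point) → GeneralPosition Y → _
    correct {m} Y _ with R , t , M , out , t≤ ← Execution.greedyProgram-outputs 𝕣 (distances Y) =
      R ∷ [] , t , out , ℕₚ.≤-trans t≤ (totalTime-bound m)
      , ↭-trans (Merges-concat M) (↭-trans (↭-reflexive (concat-map-[_] (downFrom m ℕₚ.≤-refl))) (downFrom-↭ m)) ∷ []

  module Cluster {n : ℕ} (X : Fin n → Point) {p : Point} (annulus : ∀ i → ¬ (Ball p 4# (X i) × ¬ Ball p 1# (X i)))
           (generic : GeneralPosition (clusterPoints X p)) where
    open GreedyStates 𝕣 d X

    S : List (Fin n)
    S = cluster X p

    W : Fin n → Fin n → ℝ
    W = distances X

    open LockStep 𝕣 d W S

    inBall? : ∀ i → Dec (Ball p 1# (X i))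
    inBall? i = dist (X i) p ≤? 1#

    S-unique : Unique S
    S-unique = Uniqueₚ.filter⁺ inBall? (Uniqueₚ.allFin⁺ n)

    S-ball : ∀ {i} → i ∈ S → Ball p 1# (X i)
    S-ball i∈ = proj₂ (∈-filter⁻ inBall? {xs = allFin n} i∈)

    S-outside : ∀ {i} → i ∉ S → ¬ Ball p 4# (X i)
    S-outside {i} i∉ near = annulus i (near , λ i∈B → i∉ (∈-filter⁺ inBall? (∈-allFin i) i∈B))

    -- General position speaks about positions in the list `S`; memberships translate these into
    -- vertices.
    S-distances : ∀ {i j k l} → i ∈ S → j ∈ S → k ∈ S → l ∈ S → i ≢ j → k ≢ l →
                  W i j ≡ W k l → SameEdge (i , j) (k , l)
    S-distances {i} {j} {k} {l} i∈ j∈ k∈ l∈ i≢j k≢l eq =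
      Sum.map (λ (a , b) → at i∈ k∈ a , at j∈ l∈ b) (λ (a , b) → at i∈ l∈ a , at j∈ k∈ b)
        (generic-distances (clusterPoints X p) generic
          (λ e → i≢j (at i∈ j∈ e)) (λ e → k≢l (at k∈ l∈ e))
          (trans (sym (cong₂ W (lookup-index i∈) (lookup-index j∈))) (trans eq (cong₂ W (lookup-index k∈) (lookup-index l∈)))))
      where
      at : ∀ {x y} (x∈ : x ∈ S) (y∈ : y ∈ S) → index x∈ ≡ index y∈ → x ≡ y
      at x∈ y∈ eq = trans (lookup-index x∈) (trans (cong (lookup S) eq) (sym (lookup-index y∈)))

    module _ {E : Edges n} {ps rest : List (List (Fin n))} {P Q : List (Fin n)} {u v x y : Fin n} (g : GreedyState X E)
             (r : ps ≈ P ∷ Q ∷ rest) (su : Starts u (reverse P)) (sv : Starts v Q)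
             (shortest : ∀ {x y} → Candidate ps x y → W u v ≤ W x y)
             (ex : Exact E ps) (ps↭S : concat ps ↭ S)
             (adm : Admissible E (x , y)) (greedy : ∀ e → Admissible E e → W x y ≤ edgeLength X e) where

      private
        uniq = Unique-resp-↭ (↭-sym ps↭S) S-unique
        u∈S = ∈-resp-↭ ps↭S (left-end-∈ r su sv uniq)
        v∈S = ∈-resp-↭ ps↭S (right-end-∈ r su sv uniq)

        xy≤uv : W x y ≤ W u v
        xy≤uv = greedy (u , v) (merge-admissible g r su sv ex uniq)

      no-crossing : x ∈ S → y ∉ S → ⊥
      no-crossing x∈ y∉ = separated {p} {X x} {X y} {X u} {X v} (S-ball x∈) (S-outside y∉) (S-ball u∈S) (S-ball v∈S) xy≤uv

      no-crossing′ : x ∉ S → y ∈ S → ⊥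
      no-crossing′ x∉ y∈ = separated {p} {X y} {X x} {X u} {X v} (S-ball y∈) (S-outside x∉) (S-ball u∈S) (S-ball v∈S)
        (subst (_≤ W u v) (dist-sym (X x) (X y)) xy≤uv)

      -- Greedy's edge is at most as long as the admissible `(u , v)`, and being a candidate it is
      -- at least as long. Equal lengths mean the same edge, by general position.
      greedy-merges : x ∈ S → y ∈ S → Exact ((x , y) ∷ E) ((P ++ Q) ∷ rest)
      greedy-merges x∈ y∈ = Exact-join r su sv
        (S-distances x∈ y∈ u∈S v∈S (proj₁ adm) (ends-distinct r su sv uniq) (≤-antisym xy≤uv uv≤xy)) ex
        where
        uv≤xy : W u v ≤ W x y
        uv≤xy with admissible⇒candidate g r su sv ex uniq adm (∈-resp-↭ (↭-sym ps↭S) x∈) (∈-resp-↭ (↭-sym ps↭S) y∈)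
        ... | inj₁ c = shortest c
        ... | inj₂ c = subst (W u v ≤_) (dist-sym (X y) (X x)) (shortest c)

    _∈S? : ∀ i → Dec (i ∈ S)
    i ∈S? = Any.any? (i Finₚ.≟_) S

    advance : ∀ {R R′ E x y} → Stage R R′ E → GreedyState X E → Admissible E (x , y) →
              (∀ e → Admissible E e → W x y ≤ edgeLength X e) → Simulation R R′ ((x , y) ∷ E)
    advance (done R⊆E same) _ _ _ = finished (All.map Adjacent-∷ R⊆E) same
    advance {R} {R′} {E} {x} {y} (pending r su sv sh M r′ su′ sv′ sh′ M′ len ps↭ qs↭ ex ex′) g adm greedy =
      by-cases (x ∈S?) (y ∈S?)
      where
      by-cases : Dec (x ∈ S) → Dec (y ∈ S) → Simulation R R′ ((x , y) ∷ E)
      by-cases (yes x∈) (no y∉)  = ⊥-elim (no-crossing g r su sv sh ex ps↭ adm greedy x∈ y∉)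
      by-cases (no x∉)  (yes y∈) = ⊥-elim (no-crossing′ g r su sv sh ex ps↭ adm greedy x∉ y∈)
      -- An edge outside S leaves both runs where they are.
      by-cases (no x∉)  (no y∉)  = running (merge r su sv sh M) (merge r′ su′ sv′ sh′ M′) len ps↭ qs↭
        (Exact-outside ex (λ i → x∉ (∈-resp-↭ ps↭ i)) (λ i → y∉ (∈-resp-↭ ps↭ i)))
        (Exact-outside ex′ (λ i → x∉ (∈-resp-↭ qs↭ i)) (λ i → y∉ (∈-resp-↭ qs↭ i)))
      -- The edge `(x , y)` is identified with the next joining edge of each run separately, so both
      -- advance together however their paths are listed.
      by-cases (yes x∈) (yes y∈) = running M M′ (ℕₚ.suc-injective (trans (sym (≈-length r)) (trans len (≈-length r′))))
        (↭-join r ps↭) (↭-join r′ qs↭)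
        (greedy-merges g r su sv sh ex ps↭ adm greedy x∈ y∈)
        (greedy-merges g r′ su′ sv′ sh′ ex′ qs↭ adm greedy x∈ y∈)

    simulate : ∀ {R R′ E} → Simulation R R′ [] → GreedyState X E → Simulation R R′ E
    simulate s start             = s
    simulate s (add e g adm min) = advance (stage (simulate s g)) g adm min

    -- A pending stage is incompatible with a tour: the Hamilton cycle visits the end of a path in
    -- S, but no cycle passes through an exact family of paths.
    tour-finished : ∀ {R R′ E} → Stage R R′ E → IsTour E → pathEdges R ⊆ᴱ E × SamePath R R′
    tour-finished (done R⊆E same) _ = R⊆E , same
    tour-finished (pending r su sv _ _ _ _ _ _ _ _ ps↭ _ ex _) (c , cyc , ham , same) =
      ⊥-elim (no-cycle-through ex uniq cyc
        (All.tabulate (λ {e} e∈ → Equivalence.from (same (proj₁ e) (proj₂ e)) (inj₁ e∈)))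
        (left-end-∈ r su sv uniq) (∈-resp-↭ (↭-sym ham) (∈-allFin _)))
      where uniq = Unique-resp-↭ (↭-sym ps↭) S-unique

    module _ {m : ℕ} (Y : Fin m → Point) (congruence : Congruence Y (clusterPoints X p)) where

      private
        φ = Bijection.to (proj₁ congruence)

        ι : Fin m → Fin n
        ι i = lookup S (φ i)

        vs = downFrom m ℕₚ.≤-refl

      relabelled : List (Fin n)
      relabelled = map ι vs

      relabelled-↭ : relabelled ↭ S
      relabelled-↭ =
        ↭-trans (↭-reflexive (map-∘ vs)) (↭-trans (map⁺ (lookup S) φ-↭) (↭-reflexive (map-lookup-allFin S)))
        where
        φ-↭ : map φ vs ↭ allFin (length S)
        φ-↭ = unique-↭ (Uniqueₚ.map⁺ (Bijection.injective (proj₁ congruence)) (downFrom-unique m _)) (Uniqueₚ.allFin⁺ _)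
          (λ _ → ∈-allFin _)
          (λ {j} _ → let i , φi≡j = Bijection.strictlySurjective (proj₁ congruence) j
                     in subst (_∈ map φ vs) φi≡j (∈-map⁺ φ (∈-downFrom m _ (Finₚ.toℕ<n i))))

      output : ∃[ π ] ∃[ t ] PathFindingHeuristic.Outputs heuristic (distances Y) (π ∷ []) t ×
               Merges W (map [_] relabelled) (map ι π)
      output =
        let π , t , M , out , _ = Execution.greedyProgram-outputs 𝕣 (distances Y) in
        -- Relabelling the singletons and forming singletons of the relabelled vertices are both the
        -- map sending `i` to `[ ι i ]`.
        π , t , out , subst (λ ps → Merges W ps (map ι π)) (trans (sym (map-∘ vs)) (map-∘ vs))
          (Merges-map ι (proj₂ congruence) M)

      outputPath : List (Fin n)
      outputPath = map ι (proj₁ output)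

      outputPath-merges : Merges W (map [_] relabelled) outputPath
      outputPath-merges = proj₂ (proj₂ (proj₂ output))

      outputPath-↭ : outputPath ↭ S
      outputPath-↭ =
        ↭-trans (Merges-concat outputPath-merges) (↭-trans (↭-reflexive (concat-map-[_] relabelled)) relabelled-↭)

    outputs-agree : ∀ {E m m′} → GreedyState X E → IsTour E →
                    (Y : Fin m → Point) (cong : Congruence Y (clusterPoints X p)) →
                    (Y′ : Fin m′ → Point) (cong′ : Congruence Y′ (clusterPoints X p)) →
                    pathEdges (outputPath Y cong) ⊆ᴱ E × SamePath (outputPath Y cong) (outputPath Y′ cong′)
    outputs-agree g tour Y cong Y′ cong′ = tour-finished (stage (simulate initially g)) tour
      where
      initially = initial (relabelled-↭ Y cong) (relabelled-↭ Y′ cong′) (outputPath-merges Y cong) (outputPath-merges Y′ cong′)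

fact2p3 : (𝕣 : Reals) (d : ℕ) → Scalefree 𝕣 d (Greedy 𝕣 d)
fact2p3 𝕣 d = 4# , heuristic , λ X _ E (g , tour) p annulus generic →
  let open Cluster X annulus generic
      Z      = clusterPoints X p
      itself = ⤖-id _ , λ i j → refl
  -- The witness `Q` is the heuristic's own output on the cluster, via the identity congruence.
  -- Comparing this run with itself shows that Greedy traverses it; comparing it with the run on `Y`
  -- gives the same path.
  in outputPath Z itself
   , (outputPath-↭ Z itself , proj₁ (outputs-agree g tour Z itself Z itself))
   , λ Y congruence → let π , t , out , _ = output Y congruence in
       π ∷ [] , t , out , π , here refl , proj₂ (outputs-agree g tour Y congruence Z itself)
  where
  open Euclidean 𝕣 d using (clusterPoints)
  open Geometry 𝕣 d using (4#)
  open Scalefreeness 𝕣 d
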